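{- Let $Q=\partial_\psi S$ be a $\partial_\psi$-delta operator, with $S\in\Sigma_\psi$ invertible, and let $(p_n)_{n\ge0}$ be its $\partial_\psi$-basic polynomial sequence. Then for all $n>0$: (1) $p_n(x)=Q'\,S^{ -n-1}x^n$; (2) $p_n(x)=S^{ -n}x^n-\frac{n_\psi}{n}\,(S^{ -n})'\,x^{n-1}$; (3) $p_n(x)=\frac{n_\psi}{n}\,\hat x_\psi\,S^{ -n}x^{n-1}$; (4) (ψ-Rodrigues formula) $p_n(x)=\frac{n_\psi}{n}\,\hat x_\psi\,(Q')^{ -1}p_{n-1}(x)$, where $Q'$ is invertible in $\Sigma_\psi$.
   Context: Let $F$ be a field of characteristic $0$, $P=F[x]$. Fix $(\psi_n)_{n\ge0}$ in $F$ with $\psi_0=1$, $\psi_n\ne0$, $\psi_{ -1}=0$; $n_\psi=\psi_{n-1}/\psi_n$, $n_\psi!=1/\psi_n$, $0_\psi!=1$. $\partial_\psi x^n=n_\psi x^{n-1}$ (linear); $E^a(\partial_\psi)=\sum_k\frac{a^k}{k_\psi!}\partial_\psi^k$. $\Sigma_\psi$: algebra of linear $T:P\to P$ commuting with all $E^a(\partial_\psi)$. A $\partial_\psi$-delta operator is $Q\in\Sigma_\psi$ with $Q(x)$ a nonzero constant; its $\partial_\psi$-basic sequence: $\deg p_n=n$, $p_0=1$, $p_n(0)=0$ for $n>0$, $Qp_n=n_\psi p_{n-1}$. $\hat x_\psi x^n=\frac{n+1}{(n+1)_\psi}x^{n+1}$ (linear); the Pincherle $\psi$-derivative of $T\in\Sigma_\psi$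 is $T'=T\hat x_\psi-\hat x_\psi T\in\Sigma_\psi$. -}

module Defs where

open import Algebra.Apartness.Bundles using (HeytingField; HeytingCommutativeRing)
open import Algebra.Bundles using (CommutativeRing)
open import Algebra.Module.Bundles.Raw using (RawLeftModule)
open import Algebra.Module.Morphism.Structures using (module LeftModuleMorphisms)
import Algebra.Apartness.Properties.HeytingCommutativeRing as HeytingProperties
import Algebra.Properties.Semiring.Exp as SemiringExp
import Algebra.Properties.Semiring.Mult as SemiringMult
import Function.Endo.Propositional as Endomorphisms
open import Data.List.Base using (List; []; _∷_; length; map; replicate; _++_)
open import Data.Nat.Base as ℕ using (ℕ; zero; suc; pred; NonZero)
open import Data.Product.Base using (Σ-syntax; _×_; _,_; proj₁)
open import Function.Base using (_∘_)
open import Level using (_⊔_)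

CharacteristicZero : ∀ {c ℓ₁ ℓ₂} → HeytingField c ℓ₁ ℓ₂ → Set ℓ₂
CharacteristicZero F = ∀ n → .{{NonZero n}} → (n ·ℕ 1#) # 0#
  where
  open HeytingField F
  open CommutativeRing (HeytingCommutativeRing.commutativeRing heytingCommutativeRing) using (semiring)
  open SemiringMult semiring using () renaming (_×_ to _·ℕ_)

record AdmissibleSequence {c ℓ₁ ℓ₂} (F : HeytingField c ℓ₁ ℓ₂) : Set (c ⊔ ℓ₁ ⊔ ℓ₂) where
  open HeytingField F
  field
    ψ    : ℕ → Carrier
    ψ₀≈1 : ψ 0 ≈ 1#
    ψ#0  : ∀ n → ψ n # 0#

-- "Nonzero" is read as apartness from 0#, which in a Heyting field means
-- invertible (and classically is the negation of equality with 0#).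

module PsiCalculus {c ℓ₁ ℓ₂} (F : HeytingField c ℓ₁ ℓ₂)
                   (admissible : AdmissibleSequence F) where

  open HeytingField F
  open AdmissibleSequence admissible
  open HeytingProperties heytingCommutativeRing using (x-0≈x; x#0y#0→xy#0; invertibleˡ⇒#)
  open CommutativeRing (HeytingCommutativeRing.commutativeRing heytingCommutativeRing) using (semiring)
  open SemiringMult semiring using () renaming (_×_ to _·ℕ_)
  open SemiringExp semiring using (_^_)

  inv : (x : Carrier) → x # 0# → Carrier
  inv x x#0 = proj₁ (#⇒invertible x#0)

  inv#0 : ∀ x (x#0 : x # 0#) → inv x x#0 # 0#
  inv#0 x x#0 with #⇒invertible x#0
  ... | y , _ , x-0*y≈1 =
    invertibleˡ⇒# (x - 0# , trans (*-congˡ (x-0≈x y)) x-0*y≈1)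

  infixl 7 _/_⟨_⟩
  _/_⟨_⟩ : Carrier → (y : Carrier) → y # 0# → Carrier
  x / y ⟨ y#0 ⟩ = x * inv y y#0

  fromℕ : ℕ → Carrier
  fromℕ n = n ·ℕ 1#

  -- ψpred n is ψ_{n-1}, with ψ_{-1} = 0.
  ψpred : ℕ → Carrier
  ψpred zero    = 0#
  ψpred (suc n) = ψ n

  [_]ψ : ℕ → Carrier
  [ n ]ψ = ψpred n / ψ n ⟨ ψ#0 n ⟩

  [_]ψ! : ℕ → Carrier
  [ n ]ψ! = 1# / ψ n ⟨ ψ#0 n ⟩

  [suc_]ψ#0 : ∀ n → [ suc n ]ψ # 0#
  [suc n ]ψ#0 = x#0y#0→xy#0 (ψ#0 n) (inv#0 (ψ (suc n)) (ψ#0 (suc n)))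

  [_]ψ!#0 : ∀ n → [ n ]ψ! # 0#
  [ n ]ψ!#0 = x#0y#0→xy#0 (HeytingProperties.1#0 heytingCommutativeRing) (inv#0 (ψ n) (ψ#0 n))

  -- F[x] as coefficient lists, lowest degree first.  Trailing zeros are
  -- allowed, so equality of polynomials is equality of all coefficients.
  P : Set c
  P = List Carrier

  coeff : P → ℕ → Carrier
  coeff []      _       = 0#
  coeff (a ∷ p) zero    = a
  coeff (a ∷ p) (suc n) = coeff p n

  infix 4 _≈ₚ_
  _≈ₚ_ : P → P → Set ℓ₁
  p ≈ₚ q = ∀ n → coeff p n ≈ coeff q n

  infixl 6 _+ₚ_ _-ₚ_
  infixr 7 _·_

  _+ₚ_ : P → P → P
  []      +ₚ q       = q
  (a ∷ p) +ₚ []      = a ∷ p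
  (a ∷ p) +ₚ (b ∷ q) = (a + b) ∷ (p +ₚ q)

  _·_ : Carrier → P → P
  a · p = map (a *_) p

  negₚ : P → P
  negₚ = map (λ a → - a)

  _-ₚ_ : P → P → P
  p -ₚ q = p +ₚ negₚ q

  const : Carrier → P
  const a = a ∷ []

  X^ : ℕ → P
  X^ n = replicate n 0# ++ const 1#

  eval : P → Carrier → Carrier
  eval []      a = 0#
  eval (b ∷ p) a = b + a * eval p a

  HasDegree : P → ℕ → Set (ℓ₁ ⊔ ℓ₂)
  HasDegree p n = (coeff p n # 0#) × (∀ k → n ℕ.< k → coeff p k ≈ 0#)

  polynomialSpace : RawLeftModule Carrier c ℓ₁
  polynomialSpace = record
    { Carrierᴹ = P ; _≈ᴹ_ = _≈ₚ_ ; _+ᴹ_ = _+ₚ_ ; _*ₗ_ = _·_ ; 0ᴹ = [] ; -ᴹ_ = negₚ }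

  open LeftModuleMorphisms polynomialSpace polynomialSpace public
    using () renaming (IsLeftModuleHomomorphism to IsLinear)

  open Endomorphisms P public using () renaming (_^_ to _^∘_)

  infix 4 _≗ₚ_
  _≗ₚ_ : (P → P) → (P → P) → Set (c ⊔ ℓ₁)
  T ≗ₚ U = ∀ p → T p ≈ₚ U p

  -- The linear map with xⁿ ↦ f n.
  linearExtension : (ℕ → P) → P → P
  linearExtension f []      = []
  linearExtension f (a ∷ p) = a · f 0 +ₚ linearExtension (f ∘ suc) p

  -- For n = 0 the coefficient 0_ψ vanishes, so the value of pred 0 is immaterial.
  ∂ψ : P → P
  ∂ψ = linearExtension λ n → [ n ]ψ · X^ (pred n)

  x̂ψ : P → P
  x̂ψ = linearExtension λ n → (fromℕ (suc n) / [ suc n ]ψ ⟨ [suc n ]ψ#0 ⟩) · X^ (suc n)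

  sumₚ : ℕ → (ℕ → P) → P
  sumₚ zero    f = []
  sumₚ (suc n) f = sumₚ n f +ₚ f n

  -- E^a(∂_ψ) = Σ_k (a^k / k_ψ!) ∂_ψ^k.  Since ∂_ψ lowers degrees and a list of
  -- length N has degree < N, the terms with k ≥ length p vanish at p.
  E : Carrier → P → P
  E a p = sumₚ (length p) λ k → (a ^ k / [ k ]ψ! ⟨ [ k ]ψ!#0 ⟩) · (∂ψ ^∘ k) p

  record InΣψ (T : P → P) : Set (c ⊔ ℓ₁) where
    field
      linear   : IsLinear T
      commutes : ∀ a → T ∘ E a ≗ₚ E a ∘ T

  -- T is a unit of the algebra Σ_ψ.
  record InvertibleInΣψ (T : P → P) : Set (c ⊔ ℓ₁) where
    field
      inΣψ        : InΣψ T
      inverse     : P → P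
      inverseInΣψ : InΣψ inverse
      inverseˡ    : ∀ p → inverse (T p) ≈ₚ p
      inverseʳ    : ∀ p → T (inverse p) ≈ₚ p

  open InvertibleInΣψ public using (inverse)

  record IsDelta (Q : P → P) : Set (c ⊔ ℓ₁ ⊔ ℓ₂) where
    field
      inΣψ            : InΣψ Q
      nonzeroConstant : Σ[ a ∈ Carrier ] (a # 0# × Q (X^ 1) ≈ₚ const a)

  record IsBasicSequence (Q : P → P) (p : ℕ → P) : Set (ℓ₁ ⊔ ℓ₂) where
    field
      degree  : ∀ n → HasDegree (p n) n
      initial : p 0 ≈ₚ const 1#
      vanish  : ∀ n → .{{NonZero n}} → eval (p n) 0# ≈ 0#
      lower   : ∀ n → .{{NonZero n}} → Q (p n) ≈ₚ [ n ]ψ · p (pred n)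

  pincherle : (P → P) → P → P
  pincherle T p = T (x̂ψ p) -ₚ x̂ψ (T p)

{-# OPTIONS --safe #-}
module Submission where

-- On F[x] the operators ∂ψ and x̂ψ satisfy ∂ψ x̂ψ - x̂ψ ∂ψ = 1, so the Pincherle
-- derivative is the commutator δ T = T x̂ψ - x̂ψ T, a derivation with δ ∂ψ = 1.
--
-- In characteristic 0 the algebra Σψ is the centralizer of ∂ψ: applying
-- T E^a = E^a T to a polynomial gives a polynomial identity in a, valid at all
-- natural numbers, whose linear coefficient says T ∂ψ = ∂ψ T.  The centralizer is
-- commutative because each of its elements agrees, on polynomials of bounded
-- degree, with a polynomial in ∂ψ.
--
-- For R = S⁻¹ the derivation rules give Q' = S + ∂ψ S' and (Rⁿ)' = - n S' Rⁿ⁺¹,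
-- hence f_n = Q' Rⁿ⁺¹ xⁿ is also given by (2) and (3).  By (1)
-- Q f_{n+1} = Q' Rⁿ⁺¹ ∂ψ xⁿ⁺¹ = (n+1)_ψ f_n, and by (3) f_n(0) = 0 for n > 0.  Since
-- ker Q consists of the constants, f = p.  Finally Q' = S (1 + R S' ∂ψ) is inverted
-- by a geometric series, which is finite at each polynomial, and then (4) follows
-- from (1) at n - 1 and (3) at n.

open import Defs
open import Algebra.Apartness.Bundles using (HeytingField; HeytingCommutativeRing)
open import Algebra.Bundles using (CommutativeMonoid; CommutativeRing; Ring)
open import Algebra.Module.Bundles using (LeftModule)
open import Algebra.Module.Morphism.Structures using (module LeftModuleMorphisms)
open import Data.Fin.Base using (toℕ)
open import Data.List.Base using ([]; _∷_; length)
open import Data.Nat.Base as ℕ using (ℕ; zero; suc; pred; NonZero)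
import Data.Nat.Properties as ℕ
open import Data.Product.Base using (Σ-syntax; _×_; _,_; proj₁)
open import Data.Sum.Base using (inj₁; inj₂)
open import Data.Vec.Base using (Vec; []; _∷_; tabulate)
open import Data.Vec.Relation.Unary.All using (All; []; _∷_)
open import Function.Base using (_∘_)
open import Level using (_⊔_)
import Relation.Binary.PropositionalEquality.Core as ≡
open ≡ using (_≡_; _≢_)
open import Relation.Nullary.Negation using (contradiction)

-- Commuting elements and geometric sums in a ring.

module Commutator {a ℓ} (R : Ring a ℓ) where

  open Ring R
  open import Algebra.Properties.Ring R
    using (+-cancelʳ; -‿distribˡ-*; -‿distribʳ-*; -‿involutive; x≈z//y; //-rightDividesˡ; x≈y⇒x∙y⁻¹≈ε)
  open import Algebra.Properties.CommutativeSemigroup +-commutativeSemigroup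
    using (interchange)
  open import Algebra.Properties.Semiring.Exp semiring using (_^_)
  open import Algebra.Properties.Semiring.Mult semiring using (×-congʳ; ×-comm-*) renaming (_×_ to _·ℕ_)
  open import Relation.Binary.Reasoning.Setoid setoid

  Commute : Carrier → Carrier → Set ℓ
  Commute x y = x * y ≈ y * x

  commute-0 : ∀ x → Commute x 0#
  commute-0 x = trans (zeroʳ x) (sym (zeroˡ x))

  commute-1 : ∀ x → Commute x 1#
  commute-1 x = trans (*-identityʳ x) (sym (*-identityˡ x))

  commute-+ : ∀ {x y z} → Commute x y → Commute x z → Commute x (y + z)
  commute-+ {x} {y} {z} xy xz = begin
    x * (y + z)    ≈⟨ distribˡ x y z ⟩
    x * y + x * z  ≈⟨ +-cong xy xz ⟩
    y * x + z * x  ≈⟨ distribʳ x y z ⟨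
    (y + z) * x    ∎

  commute-‿ : ∀ {x y} → Commute x y → Commute x (- y)
  commute-‿ {x} {y} xy = begin
    x * - y    ≈⟨ -‿distribʳ-* x y ⟨
    - (x * y)  ≈⟨ -‿cong xy ⟩
    - (y * x)  ≈⟨ -‿distribˡ-* y x ⟩
    - y * x    ∎

  commute-* : ∀ {x y z} → Commute x y → Commute x z → Commute x (y * z)
  commute-* {x} {y} {z} xy xz = begin
    x * (y * z)  ≈⟨ *-assoc x y z ⟨
    (x * y) * z  ≈⟨ *-congʳ xy ⟩
    (y * x) * z  ≈⟨ *-assoc y x z ⟩
    y * (x * z)  ≈⟨ *-congˡ xz ⟩
    y * (z * x)  ≈⟨ *-assoc y z x ⟨
    (y * z) * x  ∎

  commute-^ : ∀ {x y} → Commute x y → ∀ n → Commute x (y ^ n)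
  commute-^ {x} xy zero    = commute-1 x
  commute-^     xy (suc n) = commute-* xy (commute-^ xy n)

  ^-distrib-* : ∀ {x y} → Commute x y → ∀ n → (x * y) ^ n ≈ x ^ n * y ^ n
  ^-distrib-* xy zero = sym (*-identityˡ 1#)
  ^-distrib-* {x} {y} xy (suc n) = begin
    (x * y) * (x * y) ^ n      ≈⟨ *-congˡ (^-distrib-* xy n) ⟩
    (x * y) * (x ^ n * y ^ n)  ≈⟨ *-assoc x y (x ^ n * y ^ n) ⟩
    x * (y * (x ^ n * y ^ n))  ≈⟨ *-congˡ (*-assoc y (x ^ n) (y ^ n)) ⟨
    x * ((y * x ^ n) * y ^ n)  ≈⟨ *-congˡ (*-congʳ (commute-^ (sym xy) n)) ⟩
    x * ((x ^ n * y) * y ^ n)  ≈⟨ *-congˡ (*-assoc (x ^ n) y (y ^ n)) ⟩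
    x * (x ^ n * y ^ suc n)    ≈⟨ *-assoc x (x ^ n) (y ^ suc n) ⟨
    x ^ suc n * y ^ suc n      ∎

  -- With `t = δ s` and `δ d ≈ 1#` the right side is the derivative of `d * s`. The left side shows
  -- it as a unit times `1 - k`, a form that a geometric series in `k` inverts.
  unit-factorization : ∀ {d s r t} → s * r ≈ 1# → Commute d t → s * (1# + - (- (r * t) * d)) ≈ s + d * t
  unit-factorization {d} {s} {r} {t} sr≈1 dt = begin
    s * (1# + - (- (r * t) * d))      ≈⟨ distribˡ s 1# (- (- (r * t) * d)) ⟩
    s * 1# + s * - (- (r * t) * d)    ≈⟨ +-cong (*-identityʳ s) (*-congˡ (-‿distribˡ-* (- (r * t)) d)) ⟩
    s + s * (- - (r * t) * d)         ≈⟨ +-congˡ (*-congˡ (*-congʳ (-‿involutive (r * t)))) ⟩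
    s + s * ((r * t) * d)             ≈⟨ +-congˡ (*-congˡ (*-assoc r t d)) ⟩
    s + s * (r * (t * d))             ≈⟨ +-congˡ (*-assoc s r (t * d)) ⟨
    s + (s * r) * (t * d)             ≈⟨ +-congˡ (*-congʳ sr≈1) ⟩
    s + 1# * (t * d)                  ≈⟨ +-congˡ (*-identityˡ (t * d)) ⟩
    s + t * d                         ≈⟨ +-congˡ dt ⟨
    s + d * t                         ∎

  geometric : Carrier → ℕ → Carrier
  geometric k zero    = 0#
  geometric k (suc n) = geometric k n + k ^ n

  -- A telescoping sum. The remainder `k ^ n` stays on the left, so that the induction step uses
  -- only `(1 - k) + k = 1`.
  [1-k]*geometric : ∀ k n → (1# + - k) * geometric k n + k ^ n ≈ 1#
  [1-k]*geometric k zero = trans (+-congʳ (zeroʳ (1# + - k))) (+-identityˡ 1#)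
  [1-k]*geometric k (suc n) = begin
    (1# + - k) * (g + k ^ n) + k * k ^ n
      ≈⟨ +-congʳ (distribˡ (1# + - k) g (k ^ n)) ⟩
    ((1# + - k) * g + (1# + - k) * k ^ n) + k * k ^ n
      ≈⟨ +-assoc _ _ _ ⟩
    (1# + - k) * g + ((1# + - k) * k ^ n + k * k ^ n)
      ≈⟨ +-congˡ (distribʳ (k ^ n) (1# + - k) k) ⟨
    (1# + - k) * g + ((1# + - k) + k) * k ^ n
      ≈⟨ +-congˡ (*-congʳ (//-rightDividesˡ k 1#)) ⟩
    (1# + - k) * g + 1# * k ^ n
      ≈⟨ +-congˡ (*-identityˡ (k ^ n)) ⟩
    (1# + - k) * g + k ^ n
      ≈⟨ [1-k]*geometric k n ⟩
    1# ∎
    where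
    g : Carrier
    g = geometric k n

  commute-geometric : ∀ {x k} → Commute x k → ∀ n → Commute x (geometric k n)
  commute-geometric {x} xk zero    = commute-0 x
  commute-geometric     xk (suc n) = commute-+ (commute-geometric xk n) (commute-^ xk n)

  -- The inner derivation given by an element.

  module Derivation (x : Carrier) where

    δ : Carrier → Carrier
    δ y = y * x - x * y

    δ-spec : ∀ y → δ y + x * y ≈ y * x
    δ-spec y = //-rightDividesˡ (x * y) (y * x)

    -- Together with `δ-spec` this describes `δ y` by an equation free of subtraction, which keeps
    -- signs out of the computations below.
    δ-unique : ∀ {y z} → z + x * y ≈ y * x → δ y ≈ z
    δ-unique {y} {z} eq = sym (x≈z//y z (x * y) (y * x) eq)

    δ-cong : ∀ {y z} → y ≈ z → δ y ≈ δ z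
    δ-cong y≈z = +-cong (*-congʳ y≈z) (-‿cong (*-congˡ y≈z))

    δ-1 : δ 1# ≈ 0#
    δ-1 = x≈y⇒x∙y⁻¹≈ε (sym (commute-1 x))

    -- In `x * y * z` the factor `x` travels to the right: `δ y` pays for passing `y`, then `δ z`
    -- for passing `z`.
    δ-* : ∀ y z → δ (y * z) ≈ δ y * z + y * δ z
    δ-* y z = δ-unique (begin
      (δ y * z + y * δ z) + x * (y * z)  ≈⟨ +-congʳ (+-comm (δ y * z) (y * δ z)) ⟩
      (y * δ z + δ y * z) + x * (y * z)  ≈⟨ +-assoc (y * δ z) (δ y * z) (x * (y * z)) ⟩
      y * δ z + (δ y * z + x * (y * z))  ≈⟨ +-congˡ (+-congˡ (*-assoc x y z)) ⟨
      y * δ z + (δ y * z + (x * y) * z)  ≈⟨ +-congˡ (distribʳ z (δ y) (x * y)) ⟨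
      y * δ z + (δ y + x * y) * z        ≈⟨ +-congˡ (*-congʳ (δ-spec y)) ⟩
      y * δ z + (y * x) * z              ≈⟨ +-congˡ (*-assoc y x z) ⟩
      y * δ z + y * (x * z)              ≈⟨ distribˡ y (δ z) (x * z) ⟨
      y * (δ z + x * z)                  ≈⟨ *-congˡ (δ-spec z) ⟩
      y * (z * x)                        ≈⟨ *-assoc y z x ⟨
      (y * z) * x                        ∎)

    -- Applying `δ` to `d * y ≈ y * d` produces one extra summand `y` on each side, and these
    -- cancel. Hence the centralizer of `d` is closed under `δ`.
    δ-commute : ∀ {d y} → δ d ≈ 1# → Commute d y → Commute d (δ y)
    δ-commute {d} {y} δd≈1 dy = +-cancelʳ y (d * δ y) (δ y * d) (begin
      d * δ y + y        ≈⟨ +-comm (d * δ y) y ⟩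
      y + d * δ y        ≈⟨ +-congʳ (*-identityˡ y) ⟨
      1# * y + d * δ y   ≈⟨ +-congʳ (*-congʳ δd≈1) ⟨
      δ d * y + d * δ y  ≈⟨ δ-* d y ⟨
      δ (d * y)          ≈⟨ δ-cong dy ⟩
      δ (y * d)          ≈⟨ δ-* y d ⟩
      δ y * d + y * δ d  ≈⟨ +-congˡ (*-congˡ δd≈1) ⟩
      δ y * d + y * 1#   ≈⟨ +-congˡ (*-identityʳ y) ⟩
      δ y * d + y        ∎)

    module _ {s r : Carrier} (sr≈1 : s * r ≈ 1#) (rs≈1 : r * s ≈ 1#)
             (rδs : Commute r (δ s)) where

      -- The rule for the derivative of an inverse: `δ` kills `s * r ≈ 1#`, and multiplying its
      -- Leibniz expansion by `r` on the left isolates `δ r`.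
      δ-inverse : δ s * (r * r) + δ r ≈ 0#
      δ-inverse = begin
        δ s * (r * r) + δ r        ≈⟨ +-cong (*-assoc (δ s) r r) (*-identityˡ (δ r)) ⟨
        (δ s * r) * r + 1# * δ r   ≈⟨ +-cong (*-congʳ (sym rδs)) (*-congʳ (sym rs≈1)) ⟩
        (r * δ s) * r + (r * s) * δ r  ≈⟨ +-cong (*-assoc r (δ s) r) (*-assoc r s (δ r)) ⟩
        r * (δ s * r) + r * (s * δ r)  ≈⟨ distribˡ r (δ s * r) (s * δ r) ⟨
        r * (δ s * r + s * δ r)    ≈⟨ *-congˡ (δ-* s r) ⟨
        r * δ (s * r)              ≈⟨ *-congˡ (trans (δ-cong sr≈1) δ-1) ⟩
        r * 0#                     ≈⟨ zeroʳ r ⟩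
        0#                         ∎

      -- Induction by the Leibniz rule for `r * r ^ n`: the first summand contributes one more copy
      -- of `δ s * r ^ (n + 2)`, the second contributes `n` copies.
      δ-inverse-^ : ∀ n → n ·ℕ (δ s * r ^ suc n) + δ (r ^ n) ≈ 0#
      δ-inverse-^ zero    = trans (+-identityˡ (δ 1#)) δ-1
      δ-inverse-^ (suc n) = begin
        (δ s * r ^ (2 ℕ.+ n) + n ·ℕ (δ s * r ^ (2 ℕ.+ n))) + δ (r * r ^ n)
          ≈⟨ +-cong (+-cong first (×-congʳ n second)) (δ-* r (r ^ n)) ⟩
        (δ s * (r * r) * r ^ n + n ·ℕ (r * (δ s * r ^ suc n))) + (δ r * r ^ n + r * δ (r ^ n))
          ≈⟨ interchange _ _ _ _ ⟩
        (δ s * (r * r) * r ^ n + δ r * r ^ n) + (n ·ℕ (r * (δ s * r ^ suc n)) + r * δ (r ^ n))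
          ≈⟨ +-cong (sym (distribʳ (r ^ n) _ _)) (+-congʳ (sym (×-comm-* n r _))) ⟩
        (δ s * (r * r) + δ r) * r ^ n + (r * (n ·ℕ (δ s * r ^ suc n)) + r * δ (r ^ n))
          ≈⟨ +-cong (*-congʳ δ-inverse) (sym (distribˡ r _ _)) ⟩
        0# * r ^ n + r * (n ·ℕ (δ s * r ^ suc n) + δ (r ^ n))
          ≈⟨ +-cong (zeroˡ (r ^ n)) (*-congˡ (δ-inverse-^ n)) ⟩
        0# + r * 0#
          ≈⟨ trans (+-identityˡ (r * 0#)) (zeroʳ r) ⟩
        0# ∎
        where
        first : δ s * r ^ (2 ℕ.+ n) ≈ δ s * (r * r) * r ^ n
        first = begin
          δ s * (r * (r * r ^ n))  ≈⟨ *-congˡ (*-assoc r r (r ^ n)) ⟨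
          δ s * ((r * r) * r ^ n)  ≈⟨ *-assoc (δ s) (r * r) (r ^ n) ⟨
          δ s * (r * r) * r ^ n    ∎

        second : δ s * (r * r ^ suc n) ≈ r * (δ s * r ^ suc n)
        second = begin
          δ s * (r * r ^ suc n)  ≈⟨ *-assoc (δ s) r (r ^ suc n) ⟨
          (δ s * r) * r ^ suc n  ≈⟨ *-congʳ rδs ⟨
          (r * δ s) * r ^ suc n  ≈⟨ *-assoc r (δ s) (r ^ suc n) ⟩
          r * (δ s * r ^ suc n)  ∎

      -- Serves as the rule that moves `x` to the left of `r ^ n`; the second summand is the
      -- correction `- δ (r ^ n)`.
      r^n*x+nδsr^[1+n]≈x*r^n : ∀ n → r ^ n * x + n ·ℕ (δ s * r ^ suc n) ≈ x * r ^ n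
      r^n*x+nδsr^[1+n]≈x*r^n n = begin
        r ^ n * x + n ·ℕ (δ s * r ^ suc n)                ≈⟨ +-congʳ (δ-spec (r ^ n)) ⟨
        (δ (r ^ n) + x * r ^ n) + n ·ℕ (δ s * r ^ suc n)  ≈⟨ +-comm _ _ ⟩
        n ·ℕ (δ s * r ^ suc n) + (δ (r ^ n) + x * r ^ n)  ≈⟨ +-assoc _ _ _ ⟨
        (n ·ℕ (δ s * r ^ suc n) + δ (r ^ n)) + x * r ^ n  ≈⟨ +-congʳ (δ-inverse-^ n) ⟩
        0# + x * r ^ n                                   ≈⟨ +-identityˡ (x * r ^ n) ⟩
        x * r ^ n                                        ∎

      module _ {d : Carrier} (δd≈1 : δ d ≈ 1#) (rd : Commute r d) where

        δ-ds : δ (d * s) ≈ s + d * δ s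
        δ-ds = begin
          δ (d * s)          ≈⟨ δ-* d s ⟩
          δ d * s + d * δ s  ≈⟨ +-congʳ (trans (*-congʳ δd≈1) (*-identityˡ s)) ⟩
          s + d * δ s        ∎

        -- In the summand `s` of `δ (d * s)` one factor `r` cancels. In the other, `d` goes to the
        -- far right, where it will act first on a monomial.
        δ-ds*r^ : Commute d (δ s) → ∀ n → δ (d * s) * r ^ suc n ≈ r ^ n + (δ s * r ^ suc n) * d
        δ-ds*r^ dδs n = begin
          δ (d * s) * r ^ suc n                  ≈⟨ *-congʳ δ-ds ⟩
          (s + d * δ s) * r ^ suc n              ≈⟨ distribʳ (r ^ suc n) s (d * δ s) ⟩
          s * r ^ suc n + (d * δ s) * r ^ suc n  ≈⟨ +-cong left right ⟩
          r ^ n + (δ s * r ^ suc n) * d          ∎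
          where
          left : s * (r * r ^ n) ≈ r ^ n
          left = begin
            s * (r * r ^ n)  ≈⟨ *-assoc s r (r ^ n) ⟨
            (s * r) * r ^ n  ≈⟨ *-congʳ sr≈1 ⟩
            1# * r ^ n       ≈⟨ *-identityˡ (r ^ n) ⟩
            r ^ n            ∎

          right : (d * δ s) * r ^ suc n ≈ (δ s * r ^ suc n) * d
          right = trans (*-assoc d (δ s) (r ^ suc n)) (commute-* dδs (commute-^ (sym rd) (suc n)))

-- The ring of linear endomorphisms of a module.

module LinearEndomorphisms {c ℓ m ℓm} (R : CommutativeRing c ℓ)
                           (M : LeftModule (CommutativeRing.ring R) m ℓm) where

  open CommutativeRing R using (Carrier; _*_; *-comm; 1#) renaming (refl to ≈-refl; semiring to scalarSemiring)
  open LeftModule M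
  open import Algebra.Properties.AbelianGroup +ᴹ-abelianGroup
    using (⁻¹-∙-comm; inverseˡ-unique; identityʳ-unique)
  open import Algebra.Properties.CommutativeSemigroup
    (CommutativeMonoid.commutativeSemigroup +ᴹ-commutativeMonoid)
    using (interchange)
  open import Algebra.Properties.Semiring.Mult scalarSemiring using () renaming (_×_ to _·ℕₛ_)
  open import Relation.Binary.Reasoning.Setoid ≈ᴹ-setoid

  open LeftModuleMorphisms rawLeftModule rawLeftModule public
    using () renaming (IsLeftModuleHomomorphism to IsLinearᴹ; module IsLeftModuleHomomorphism to IsLinearᴹ)

  -ᴹ-scale : ∀ a v → a *ₗ (-ᴹ v) ≈ᴹ -ᴹ (a *ₗ v)
  -ᴹ-scale a v = inverseˡ-unique (a *ₗ (-ᴹ v)) (a *ₗ v) (begin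
    a *ₗ (-ᴹ v) +ᴹ a *ₗ v  ≈⟨ *ₗ-distribˡ a (-ᴹ v) v ⟨
    a *ₗ (-ᴹ v +ᴹ v)       ≈⟨ *ₗ-cong ≈-refl (-ᴹ‿inverseˡ v) ⟩
    a *ₗ 0ᴹ                ≈⟨ *ₗ-zeroʳ a ⟩
    0ᴹ                     ∎)

  -- Additivity already forces zero and negatives to be preserved, by uniqueness of the identity and
  -- of inverses.
  mkLinear : ∀ {f : Carrierᴹ → Carrierᴹ} → (∀ {u v} → u ≈ᴹ v → f u ≈ᴹ f v) →
             (∀ u v → f (u +ᴹ v) ≈ᴹ f u +ᴹ f v) → (∀ a v → f (a *ₗ v) ≈ᴹ a *ₗ f v) → IsLinearᴹ f
  mkLinear {f} f-cong f-+ f-* = record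
    { +ᴹ-isGroupHomomorphism = record
      { isMonoidHomomorphism = record
        { isMagmaHomomorphism = record
          { isRelHomomorphism = record { cong = f-cong } ; homo = f-+ }
        ; ε-homo = f-0
        }
      ; ⁻¹-homo = λ v → inverseˡ-unique (f (-ᴹ v)) (f v) (begin
          f (-ᴹ v) +ᴹ f v  ≈⟨ f-+ (-ᴹ v) v ⟨
          f (-ᴹ v +ᴹ v)    ≈⟨ f-cong (-ᴹ‿inverseˡ v) ⟩
          f 0ᴹ             ≈⟨ f-0 ⟩
          0ᴹ               ∎)
      }
    ; *ₗ-homo = f-*
    }
    where
    f-0 : f 0ᴹ ≈ᴹ 0ᴹ
    f-0 = identityʳ-unique (f 0ᴹ) (f 0ᴹ) (begin
      f 0ᴹ +ᴹ f 0ᴹ  ≈⟨ f-+ 0ᴹ 0ᴹ ⟨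
      f (0ᴹ +ᴹ 0ᴹ)  ≈⟨ f-cong (+ᴹ-identityˡ 0ᴹ) ⟩
      f 0ᴹ          ∎)

  record End : Set (c ⊔ m ⊔ ℓm) where
    -- Eta would make the conversion checker unfold products of operators.
    no-eta-equality
    field
      ⟦_⟧    : Carrierᴹ → Carrierᴹ
      linear : IsLinearᴹ ⟦_⟧
    open IsLinearᴹ linear public using (⟦⟧-cong; +ᴹ-homo; *ₗ-homo; 0ᴹ-homo; -ᴹ-homo)

  open End public

  infix 4 _≐_
  record _≐_ (T U : End) : Set (m ⊔ ℓm) where
    constructor pointwise
    field _$ᴹ_ : ∀ v → ⟦ T ⟧ v ≈ᴹ ⟦ U ⟧ v
  open _≐_ public

  infixl 6 _⊕_
  infixl 7 _⊛_

  _⊕_ _⊛_ : End → End → End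
  ⟦ T ⊕ U ⟧ v    = ⟦ T ⟧ v +ᴹ ⟦ U ⟧ v
  (T ⊕ U) .linear = mkLinear
    (λ u≈v → +ᴹ-cong (⟦⟧-cong T u≈v) (⟦⟧-cong U u≈v))
    (λ u v → ≈ᴹ-trans (+ᴹ-cong (+ᴹ-homo T u v) (+ᴹ-homo U u v)) (interchange _ _ _ _))
    (λ a v → ≈ᴹ-trans (+ᴹ-cong (*ₗ-homo T a v) (*ₗ-homo U a v)) (≈ᴹ-sym (*ₗ-distribˡ a _ _)))
  ⟦ T ⊛ U ⟧ v    = ⟦ T ⟧ (⟦ U ⟧ v)
  (T ⊛ U) .linear = mkLinear
    (λ u≈v → ⟦⟧-cong T (⟦⟧-cong U u≈v))
    (λ u v → ≈ᴹ-trans (⟦⟧-cong T (+ᴹ-homo U u v)) (+ᴹ-homo T _ _))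
    (λ a v → ≈ᴹ-trans (⟦⟧-cong T (*ₗ-homo U a v)) (*ₗ-homo T a _))

  ⊖_ : End → End
  ⟦ ⊖ T ⟧ v    = -ᴹ (⟦ T ⟧ v)
  (⊖ T) .linear = mkLinear
    (λ u≈v → -ᴹ‿cong (⟦⟧-cong T u≈v))
    (λ u v → ≈ᴹ-trans (-ᴹ‿cong (+ᴹ-homo T u v)) (≈ᴹ-sym (⁻¹-∙-comm _ _)))
    (λ a v → ≈ᴹ-trans (-ᴹ‿cong (*ₗ-homo T a v)) (≈ᴹ-sym (-ᴹ-scale a _)))

  0E 1E : End
  ⟦ 0E ⟧ _  = 0ᴹ
  0E .linear = mkLinear (λ _ → ≈ᴹ-refl) (λ _ _ → ≈ᴹ-sym (+ᴹ-identityˡ 0ᴹ)) (λ a _ → ≈ᴹ-sym (*ₗ-zeroʳ a))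
  ⟦ 1E ⟧ v  = v
  1E .linear = mkLinear (λ u≈v → u≈v) (λ _ _ → ≈ᴹ-refl) (λ _ _ → ≈ᴹ-refl)

  homothety : Carrier → End
  ⟦ homothety a ⟧     = a *ₗ_
  homothety a .linear = mkLinear (*ₗ-cong ≈-refl) (*ₗ-distribˡ a)
    (λ b v → ≈ᴹ-trans (≈ᴹ-sym (*ₗ-assoc a b v))
      (≈ᴹ-trans (*ₗ-cong (*-comm a b) ≈ᴹ-refl) (*ₗ-assoc b a v)))

  endRing : Ring (c ⊔ m ⊔ ℓm) (m ⊔ ℓm)
  endRing = record
    { Carrier = End ; _≈_ = _≐_ ; _+_ = _⊕_ ; _*_ = _⊛_ ; -_ = ⊖_ ; 0# = 0E ; 1# = 1E
    ; isRing = record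
      { +-isAbelianGroup = record
        { isGroup = record
          { isMonoid = record
            { isSemigroup = record
              { isMagma = record
                { isEquivalence = record
                  { refl  = pointwise λ _ → ≈ᴹ-refl
                  ; sym   = λ T≐U → pointwise λ v → ≈ᴹ-sym (T≐U $ᴹ v)
                  ; trans = λ T≐U U≐V → pointwise λ v → ≈ᴹ-trans (T≐U $ᴹ v) (U≐V $ᴹ v)
                  }
                ; ∙-cong = λ T≐T′ U≐U′ → pointwise λ v → +ᴹ-cong (T≐T′ $ᴹ v) (U≐U′ $ᴹ v)
                }
              ; assoc = λ _ _ _ → pointwise λ _ → +ᴹ-assoc _ _ _
              }
            ; identity = (λ _ → pointwise λ _ → +ᴹ-identityˡ _) , (λ _ → pointwise λ _ → +ᴹ-identityʳ _)
            }
          ; inverse = (λ _ → pointwise λ _ → -ᴹ‿inverseˡ _) , (λ _ → pointwise λ _ → -ᴹ‿inverseʳ _)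
          ; ⁻¹-cong = λ T≐U → pointwise λ v → -ᴹ‿cong (T≐U $ᴹ v)
          }
        ; comm = λ _ _ → pointwise λ _ → +ᴹ-comm _ _
        }
      ; *-cong = λ {T} {T′} {U} {U′} T≐T′ U≐U′ → pointwise λ v →
          ≈ᴹ-trans (⟦⟧-cong T (U≐U′ $ᴹ v)) (T≐T′ $ᴹ ⟦ U′ ⟧ v)
      ; *-assoc = λ _ _ _ → pointwise λ _ → ≈ᴹ-refl
      ; *-identity = (λ _ → pointwise λ _ → ≈ᴹ-refl) , (λ _ → pointwise λ _ → ≈ᴹ-refl)
      ; distrib = (λ T U V → pointwise λ v → +ᴹ-homo T (⟦ U ⟧ v) (⟦ V ⟧ v)) , (λ _ _ _ → pointwise λ _ → ≈ᴹ-refl)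
      }
    }

  open import Algebra.Properties.Semiring.Mult (Ring.semiring endRing) using () renaming (_×_ to _·ℕ_)

  -- Links the integer multiples in the abstract commutator identities with the scalars `fromℕ n`
  -- acting on polynomials.
  ·ℕ-apply : ∀ n T v → ⟦ n ·ℕ T ⟧ v ≈ᴹ (n ·ℕₛ 1#) *ₗ ⟦ T ⟧ v
  ·ℕ-apply zero    T v = ≈ᴹ-sym (*ₗ-zeroˡ (⟦ T ⟧ v))
  ·ℕ-apply (suc n) T v = ≈ᴹ-sym (≈ᴹ-trans (*ₗ-distribʳ (⟦ T ⟧ v) 1# (n ·ℕₛ 1#))
    (+ᴹ-cong (*ₗ-identityˡ (⟦ T ⟧ v)) (≈ᴹ-sym (·ℕ-apply n T v))))

  homothety-commute : ∀ a T → homothety a ⊛ T ≐ T ⊛ homothety a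
  homothety-commute a T = pointwise λ v → ≈ᴹ-sym (*ₗ-homo T a v)

-- Inverses in a Heyting field.

module HeytingFieldProperties {c ℓ₁ ℓ₂} (F : HeytingField c ℓ₁ ℓ₂) where

  open HeytingField F using (_#_; heytingCommutativeRing; #⇒invertible)
  open import Algebra.Apartness.Properties.HeytingCommutativeRing heytingCommutativeRing using (x-0≈x)
  open CommutativeRing (HeytingCommutativeRing.commutativeRing heytingCommutativeRing)

  -- Apartness supplies an inverse of the difference `x - 0#`, which is first rewritten to `x`.
  inv-inverseˡ : ∀ {x} (x#0 : x # 0#) → proj₁ (#⇒invertible x#0) * x ≈ 1#
  inv-inverseˡ {x} x#0 with #⇒invertible x#0
  ... | y , y*[x-0]≈1 , _ = trans (*-congˡ (sym (x-0≈x x))) y*[x-0]≈1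

  inv-inverseʳ : ∀ {x} (x#0 : x # 0#) → x * proj₁ (#⇒invertible x#0) ≈ 1#
  inv-inverseʳ x#0 = trans (*-comm _ _) (inv-inverseˡ x#0)

  module Scaling {m ℓm} (M : LeftModule ring m ℓm) where

    open LeftModule M
    open import Relation.Binary.Reasoning.Setoid ≈ᴹ-setoid

    *ₗ-cancel-0 : ∀ {a v} → a # 0# → a *ₗ v ≈ᴹ 0ᴹ → v ≈ᴹ 0ᴹ
    *ₗ-cancel-0 {a} {v} a#0 av≈0 = begin
      v                ≈⟨ *ₗ-identityˡ v ⟨
      1# *ₗ v          ≈⟨ *ₗ-cong (inv-inverseˡ a#0) ≈ᴹ-refl ⟨
      (a⁻¹ * a) *ₗ v   ≈⟨ *ₗ-assoc a⁻¹ a v ⟩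
      a⁻¹ *ₗ (a *ₗ v)  ≈⟨ *ₗ-cong refl av≈0 ⟩
      a⁻¹ *ₗ 0ᴹ        ≈⟨ *ₗ-zeroʳ a⁻¹ ⟩
      0ᴹ               ∎
      where
      a⁻¹ : Carrier
      a⁻¹ = proj₁ (#⇒invertible a#0)

-- Polynomial functions with vector coefficients and their roots.

module VectorPolynomials {c ℓ₁ ℓ₂ m ℓm} (F : HeytingField c ℓ₁ ℓ₂)
    (M : LeftModule (CommutativeRing.ring (HeytingCommutativeRing.commutativeRing
      (HeytingField.heytingCommutativeRing F))) m ℓm) where

  open CommutativeRing (HeytingCommutativeRing.commutativeRing (HeytingField.heytingCommutativeRing F))
  open HeytingFieldProperties F
  open Scaling M
  open LeftModule M
  open import Algebra.Properties.AbelianGroup +ᴹ-abelianGroup using (∙-cancelˡ; identityʳ-unique)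
  open import Algebra.Properties.CommutativeSemigroup
    (CommutativeMonoid.commutativeSemigroup +ᴹ-commutativeMonoid)
    using (interchange)
  open import Algebra.Properties.Semiring.Mult semiring using (×-homo-+; ×-congˡ) renaming (_×_ to _·ℕ_)
  open import Relation.Binary.Reasoning.Setoid ≈ᴹ-setoid

  horner : ∀ {n} → Vec Carrierᴹ n → Carrier → Carrierᴹ
  horner []       a = 0ᴹ
  horner (v ∷ vs) a = v +ᴹ a *ₗ horner vs a

  -- The quotient of v ∷ vs by x - r, which does not depend on v.
  quotient : ∀ {n} → Carrier → Vec Carrierᴹ n → Vec Carrierᴹ n
  quotient r []       = []
  quotient r (v ∷ vs) = horner (v ∷ vs) r ∷ quotient r vs

  -- a f(a) - r f(r) = (a - r) g(a) for the quotient g, with both sides moved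
  -- so that no subtraction occurs.
  quotient-spec : ∀ {n} (vs : Vec Carrierᴹ n) a r →
    a *ₗ horner vs a +ᴹ r *ₗ horner (quotient r vs) a ≈ᴹ
    r *ₗ horner vs r +ᴹ a *ₗ horner (quotient r vs) a
  quotient-spec [] a r = +ᴹ-comm _ _
  quotient-spec (v ∷ vs) a r = begin
    a *ₗ (v +ᴹ a *ₗ f a) +ᴹ r *ₗ (w +ᴹ a *ₗ g)
      ≈⟨ +ᴹ-cong (*ₗ-distribˡ a v _) (*ₗ-distribˡ r w _) ⟩
    (a *ₗ v +ᴹ a *ₗ (a *ₗ f a)) +ᴹ (r *ₗ w +ᴹ r *ₗ (a *ₗ g))
      ≈⟨ interchange _ _ _ _ ⟩
    (a *ₗ v +ᴹ r *ₗ w) +ᴹ (a *ₗ (a *ₗ f a) +ᴹ r *ₗ (a *ₗ g))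
      ≈⟨ +ᴹ-cong (+ᴹ-comm _ _) (begin
           a *ₗ (a *ₗ f a) +ᴹ r *ₗ (a *ₗ g)
             ≈⟨ +ᴹ-cong ≈ᴹ-refl (swap r a g) ⟩
           a *ₗ (a *ₗ f a) +ᴹ a *ₗ (r *ₗ g)
             ≈⟨ *ₗ-distribˡ a _ _ ⟨
           a *ₗ (a *ₗ f a +ᴹ r *ₗ g)
             ≈⟨ *ₗ-cong refl (quotient-spec vs a r) ⟩
           a *ₗ (r *ₗ f r +ᴹ a *ₗ g)
             ≈⟨ *ₗ-distribˡ a _ _ ⟩
           a *ₗ (r *ₗ f r) +ᴹ a *ₗ (a *ₗ g) ∎) ⟩
    (r *ₗ w +ᴹ a *ₗ v) +ᴹ (a *ₗ (r *ₗ f r) +ᴹ a *ₗ (a *ₗ g))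
      ≈⟨ +ᴹ-assoc _ _ _ ⟩
    r *ₗ w +ᴹ (a *ₗ v +ᴹ (a *ₗ (r *ₗ f r) +ᴹ a *ₗ (a *ₗ g)))
      ≈⟨ +ᴹ-cong ≈ᴹ-refl (+ᴹ-assoc _ _ _) ⟨
    r *ₗ w +ᴹ ((a *ₗ v +ᴹ a *ₗ (r *ₗ f r)) +ᴹ a *ₗ (a *ₗ g))
      ≈⟨ +ᴹ-cong ≈ᴹ-refl (+ᴹ-cong (*ₗ-distribˡ a v _) ≈ᴹ-refl) ⟨
    r *ₗ w +ᴹ (a *ₗ w +ᴹ a *ₗ (a *ₗ g))
      ≈⟨ +ᴹ-cong ≈ᴹ-refl (*ₗ-distribˡ a w _) ⟨
    r *ₗ w +ᴹ a *ₗ (w +ᴹ a *ₗ g) ∎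
    where
    f : Carrier → Carrierᴹ
    f = horner vs

    w g : Carrierᴹ
    w = v +ᴹ r *ₗ f r
    g = horner (quotient r vs) a

    swap : ∀ a b v → a *ₗ (b *ₗ v) ≈ᴹ b *ₗ (a *ₗ v)
    swap a b v = ≈ᴹ-trans (≈ᴹ-sym (*ₗ-assoc a b v)) (≈ᴹ-trans (*ₗ-cong (*-comm a b) ≈ᴹ-refl) (*ₗ-assoc b a v))

  AllZero : ∀ {n} → Vec Carrierᴹ n → Set (m ⊔ ℓm)
  AllZero = All (_≈ᴹ 0ᴹ)

  horner-zero : ∀ {n} {vs : Vec Carrierᴹ n} → AllZero vs → ∀ a → horner vs a ≈ᴹ 0ᴹ
  horner-zero []           a = ≈ᴹ-refl
  horner-zero (v≈0 ∷ vs≈0) a = ≈ᴹ-trans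
    (+ᴹ-cong v≈0 (≈ᴹ-trans (*ₗ-cong refl (horner-zero vs≈0 a)) (*ₗ-zeroʳ a))) (+ᴹ-identityˡ 0ᴹ)

  head-zero : ∀ {n v} {vs : Vec Carrierᴹ n} {a} → AllZero vs → horner (v ∷ vs) a ≈ᴹ 0ᴹ → v ≈ᴹ 0ᴹ
  head-zero {v = v} {vs} {a} vs≈0 eq = begin
    v                      ≈⟨ +ᴹ-identityʳ v ⟨
    v +ᴹ 0ᴹ                ≈⟨ +ᴹ-cong ≈ᴹ-refl (≈ᴹ-trans (*ₗ-cong refl (horner-zero vs≈0 a)) (*ₗ-zeroʳ a)) ⟨
    v +ᴹ a *ₗ horner vs a  ≈⟨ eq ⟩
    0ᴹ                     ∎

  -- Synthetic division is triangular: once the later coefficients vanish, each entry of the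
  -- quotient reduces to the coefficient at its place.
  quotient-zero : ∀ {n} r (vs : Vec Carrierᴹ n) → AllZero (quotient r vs) → AllZero vs
  quotient-zero r []       []           = []
  quotient-zero r (v ∷ vs) (w≈0 ∷ ws≈0) = head-zero vs≈0 w≈0 ∷ vs≈0
    where
    vs≈0 : AllZero vs
    vs≈0 = quotient-zero r vs ws≈0

  module _ (charZero : CharacteristicZero F) where

    -- A polynomial with too many roots is zero. Dividing out the root `s` leaves a shorter
    -- polynomial with the roots `s + 1`, `s + 2` and so on, which is why the starting point `s`
    -- varies in the induction.
    vanishing : ∀ {n} (vs : Vec Carrierᴹ n) s →
                (∀ i → horner vs ((s ℕ.+ i) ·ℕ 1#) ≈ᴹ 0ᴹ) → AllZero vs
    vanishing []       s eq = []
    vanishing (v ∷ vs) s eq = head-zero vs≈0 (eq 0) ∷ vs≈0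
      where
      r : Carrier
      r = (s ℕ.+ 0) ·ℕ 1#

      root : ∀ i → horner (quotient r vs) ((suc s ℕ.+ i) ·ℕ 1#) ≈ᴹ 0ᴹ
      -- The equation `a *ₗ g ≈ᴹ r *ₗ g` with `a ≈ r + (i + 1)` leaves `(i + 1) *ₗ g ≈ᴹ 0ᴹ`, and
      -- characteristic zero makes `i + 1` invertible.
      root i = *ₗ-cancel-0 (charZero (suc i)) (identityʳ-unique (r *ₗ g) _ (begin
        r *ₗ g +ᴹ (suc i ·ℕ 1#) *ₗ g  ≈⟨ *ₗ-distribʳ g r (suc i ·ℕ 1#) ⟨
        (r + suc i ·ℕ 1#) *ₗ g        ≈⟨ *ₗ-cong a≈r+1+i ≈ᴹ-refl ⟨
        a *ₗ g                       ≈⟨ ag≈rg ⟩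
        r *ₗ g                       ∎))
        where
        a : Carrier
        a = (suc s ℕ.+ i) ·ℕ 1#

        g : Carrierᴹ
        g = horner (quotient r vs) a

        a≈r+1+i : a ≈ r + suc i ·ℕ 1#
        a≈r+1+i = trans (×-congˡ (≡.trans (≡.sym (ℕ.+-suc s i)) (≡.cong (ℕ._+ suc i) (≡.sym (ℕ.+-identityʳ s)))))
          (×-homo-+ 1# (s ℕ.+ 0) (suc i))

        af≈rf : a *ₗ horner vs a ≈ᴹ r *ₗ horner vs r
        -- Both `a` and `r` are roots of `v ∷ vs`, so the constant coefficient `v` cancels.
        af≈rf = ∙-cancelˡ v _ _ (≈ᴹ-trans
          (≡.subst (λ k → horner (v ∷ vs) (k ·ℕ 1#) ≈ᴹ 0ᴹ) (ℕ.+-suc s i) (eq (suc i)))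
          (≈ᴹ-sym (eq 0)))

        ag≈rg : a *ₗ g ≈ᴹ r *ₗ g
        ag≈rg = ≈ᴹ-sym (∙-cancelˡ (r *ₗ horner vs r) _ _
          (≈ᴹ-trans (+ᴹ-cong (≈ᴹ-sym af≈rf) ≈ᴹ-refl) (quotient-spec vs a r)))

      vs≈0 : AllZero vs
      vs≈0 = quotient-zero r vs (vanishing (quotient r vs) (suc s) root)

-- The module of polynomials.

module PolynomialOperators {c ℓ₁ ℓ₂} (F : HeytingField c ℓ₁ ℓ₂) (admissible : AdmissibleSequence F) where

  open PsiCalculus F admissible

  K : CommutativeRing c ℓ₁
  K = HeytingCommutativeRing.commutativeRing (HeytingField.heytingCommutativeRing F)

  open CommutativeRing K
  open HeytingField F using (_#_)
  open HeytingFieldProperties F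
  open import Algebra.Apartness.Properties.HeytingCommutativeRing
    (HeytingField.heytingCommutativeRing F) using (1#0; x#0y#0→xy#0)
  open import Algebra.Properties.Ring ring using (-0#≈0#)
  open import Algebra.Properties.Semiring.Exp semiring using () renaming (_^_ to _^ₖ_)

  infix 4 _≋_

  -- Unlike _≈ₚ_, which unfolds to a function type, this record lets Agda
  -- recover the two polynomials from the type of an equation.
  record _≋_ (p q : P) : Set ℓ₁ where
    constructor coeffwise
    field coeff≈ : p ≈ₚ q
  open _≋_ public

  coeff-+ : ∀ p q n → coeff (p +ₚ q) n ≈ coeff p n + coeff q n
  coeff-+ []      q       n       = sym (+-identityˡ (coeff q n))
  coeff-+ (a ∷ p) []      n       = sym (+-identityʳ (coeff (a ∷ p) n))
  coeff-+ (a ∷ p) (b ∷ q) zero    = refl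
  coeff-+ (a ∷ p) (b ∷ q) (suc n) = coeff-+ p q n

  coeff-· : ∀ a p n → coeff (a · p) n ≈ a * coeff p n
  coeff-· a []      n       = sym (zeroʳ a)
  coeff-· a (b ∷ p) zero    = refl
  coeff-· a (b ∷ p) (suc n) = coeff-· a p n

  coeff-neg : ∀ p n → coeff (negₚ p) n ≈ - coeff p n
  coeff-neg []      n       = sym -0#≈0#
  coeff-neg (a ∷ p) zero    = refl
  coeff-neg (a ∷ p) (suc n) = coeff-neg p n

  +ₚ-via : ∀ p q u → (∀ n → coeff p n + coeff q n ≈ coeff u n) → p +ₚ q ≋ u
  +ₚ-via p q _ eq = coeffwise λ n → trans (coeff-+ p q n) (eq n)

  ·-via : ∀ a p u → (∀ n → a * coeff p n ≈ coeff u n) → a · p ≋ u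
  ·-via a p _ eq = coeffwise λ n → trans (coeff-· a p n) (eq n)

  polynomials : LeftModule ring c ℓ₁
  polynomials = record
    { Carrierᴹ = P ; _≈ᴹ_ = _≋_ ; _+ᴹ_ = _+ₚ_ ; _*ₗ_ = _·_ ; 0ᴹ = [] ; -ᴹ_ = negₚ
    ; isLeftModule = record
      { isLeftSemimodule = record
        { +ᴹ-isCommutativeMonoid = record
          { isMonoid = record
            { isSemigroup = record
              { isMagma = record
                { isEquivalence = record
                  { refl  = coeffwise λ _ → refl
                  ; sym   = λ p≋q → coeffwise λ n → sym (coeff≈ p≋q n)
                  ; trans = λ p≋q q≋u → coeffwise λ n → trans (coeff≈ p≋q n) (coeff≈ q≋u n)
                  }
                ; ∙-cong = λ {p} {q} {u} {v} p≋q u≋v → +ₚ-via p u (q +ₚ v) λ n →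
                    trans (+-cong (coeff≈ p≋q n) (coeff≈ u≋v n)) (sym (coeff-+ q v n))
                }
              ; assoc = λ p q u → +ₚ-via (p +ₚ q) u (p +ₚ (q +ₚ u)) λ n →
                  trans (+-congʳ (coeff-+ p q n)) (trans (+-assoc _ _ _)
                    (sym (trans (coeff-+ p (q +ₚ u) n) (+-congˡ (coeff-+ q u n)))))
              }
            ; identity = (λ p → +ₚ-via [] p p λ _ → +-identityˡ _) , (λ p → +ₚ-via p [] p λ _ → +-identityʳ _)
            }
          ; comm = λ p q → +ₚ-via p q (q +ₚ p) λ n → trans (+-comm _ _) (sym (coeff-+ q p n))
          }
        ; isPreleftSemimodule = record
          { *ₗ-cong = λ {a} {b} {p} {q} a≈b p≋q → ·-via a p (b · q) λ n →
              trans (*-cong a≈b (coeff≈ p≋q n)) (sym (coeff-· b q n))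
          ; *ₗ-zeroˡ = λ p → ·-via 0# p [] λ _ → zeroˡ _
          ; *ₗ-distribʳ = λ p a b → ·-via (a + b) p (a · p +ₚ b · p) λ n → trans (distribʳ _ a b)
              (sym (trans (coeff-+ (a · p) (b · p) n) (+-cong (coeff-· a p n) (coeff-· b p n))))
          ; *ₗ-identityˡ = λ p → ·-via 1# p p λ _ → *-identityˡ _
          ; *ₗ-assoc = λ a b p → ·-via (a * b) p (a · b · p) λ n → trans (*-assoc a b _)
              (sym (trans (coeff-· a (b · p) n) (*-congˡ (coeff-· b p n))))
          ; *ₗ-zeroʳ = λ _ → coeffwise λ _ → refl
          ; *ₗ-distribˡ = λ a p q → ·-via a (p +ₚ q) (a · p +ₚ a · q) λ n → trans (*-congˡ (coeff-+ p q n)) (trans (distribˡ a _ _)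
              (sym (trans (coeff-+ (a · p) (a · q) n) (+-cong (coeff-· a p n) (coeff-· a q n)))))
          }
        }
      ; -ᴹ‿cong = λ {p} {q} p≋q → coeffwise λ n →
          trans (coeff-neg p n) (trans (-‿cong (coeff≈ p≋q n)) (sym (coeff-neg q n)))
      ; -ᴹ‿inverse = (λ p → +ₚ-via (negₚ p) p [] λ n → trans (+-congʳ (coeff-neg p n)) (-‿inverseˡ _))
                   , (λ p → +ₚ-via p (negₚ p) [] λ n → trans (+-congˡ (coeff-neg p n)) (-‿inverseʳ _))
      }
    }

  open LeftModule polynomials
    using (≈ᴹ-setoid; ≈ᴹ-refl; ≈ᴹ-sym; ≈ᴹ-trans; ≈ᴹ-reflexive; +ᴹ-cong; +ᴹ-assoc; +ᴹ-comm;
           +ᴹ-identityˡ; +ᴹ-identityʳ; +ᴹ-commutativeMonoid; +ᴹ-abelianGroup; -ᴹ‿cong;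
           *ₗ-cong; *ₗ-zeroˡ; *ₗ-assoc; *ₗ-identityˡ; *ₗ-distribˡ; *ₗ-distribʳ)
  open Scaling polynomials
  open VectorPolynomials F polynomials
  open LinearEndomorphisms K polynomials
  open Ring endRing using () renaming (refl to ≐-refl; sym to ≐-sym; trans to ≐-trans)
  open Commutator endRing
  open import Algebra.Properties.AbelianGroup +ᴹ-abelianGroup
    using (x∙y⁻¹≈ε⇒x≈y; x≈y⇒x∙y⁻¹≈ε; ⁻¹-∙-comm; x≈z//y; //-rightDividesˡ)
  open import Algebra.Properties.CommutativeSemigroup
    (CommutativeMonoid.commutativeSemigroup +ᴹ-commutativeMonoid)
    using (interchange)
  open import Algebra.Properties.Semiring.Exp (Ring.semiring endRing) using (_^_)
  open import Algebra.Properties.Semiring.Mult (Ring.semiring endRing) using () renaming (_×_ to _·ℕ_)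
  open import Relation.Binary.Reasoning.Setoid ≈ᴹ-setoid

  toEnd : ∀ {T} → IsLinear T → End
  ⟦ toEnd {T} T-linear ⟧ = T
  toEnd T-linear .linear = mkLinear
    (λ p≋q → coeffwise (T.⟦⟧-cong (coeff≈ p≋q)))
    (λ p q → coeffwise (T.+ᴹ-homo p q))
    (λ a p → coeffwise (T.*ₗ-homo a p))
    where module T = IsLinear T-linear

  isLinear : ∀ T → IsLinear ⟦ T ⟧
  isLinear T = record
    { +ᴹ-isGroupHomomorphism = record
      { isMonoidHomomorphism = record
        { isMagmaHomomorphism = record
          { isRelHomomorphism = record { cong = λ p≈q → coeff≈ (⟦⟧-cong T (coeffwise p≈q)) }
          ; homo = λ p q → coeff≈ (+ᴹ-homo T p q)
          }
        ; ε-homo = coeff≈ (0ᴹ-homo T)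
        }
      ; ⁻¹-homo = λ p → coeff≈ (-ᴹ-homo T p)
      }
    ; *ₗ-homo = λ a p → coeff≈ (*ₗ-homo T a p)
    }

  ^-apply : ∀ T n p → ⟦ T ^ n ⟧ p ≡ (⟦ T ⟧ ^∘ n) p
  ^-apply T zero    p = ≡.refl
  ^-apply T (suc n) p = ≡.cong ⟦ T ⟧ (^-apply T n p)

  -- Linear maps determined by their values on monomials.

  e : ℕ → P
  e = X^

  shift : End
  ⟦ shift ⟧ p   = 0# ∷ p
  shift .linear = mkLinear
    (λ p≋q → coeffwise λ { zero → refl ; (suc n) → coeff≈ p≋q n })
    (λ p q → coeffwise λ { zero → sym (+-identityˡ 0#) ; (suc n) → refl })
    (λ a p → coeffwise λ { zero → sym (zeroʳ a) ; (suc n) → refl })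

  ∷-split : ∀ a p → a ∷ p ≋ a · e 0 +ₚ ⟦ shift ⟧ p
  ∷-split a p = coeffwise λ
    { zero    → sym (trans (+-identityʳ (a * 1#)) (*-identityʳ a))
    ; (suc n) → refl
    }

  -- Induction on the list, with the tail absorbed by composing both operators with `shift`. The
  -- bound on `k` lets operators that agree only in low degrees be exchanged.
  agree : ∀ T U p → (∀ k → k ℕ.< length p → ⟦ T ⟧ (e k) ≋ ⟦ U ⟧ (e k)) → ⟦ T ⟧ p ≋ ⟦ U ⟧ p
  agree T U []      eq = ≈ᴹ-trans (0ᴹ-homo T) (≈ᴹ-sym (0ᴹ-homo U))
  agree T U (a ∷ p) eq = begin
    ⟦ T ⟧ (a ∷ p)                           ≈⟨ split T ⟩
    a · ⟦ T ⟧ (e 0) +ₚ ⟦ T ⟧ (⟦ shift ⟧ p)  ≈⟨ +ᴹ-cong (*ₗ-cong refl (eq 0 ℕ.z<s))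
                                                 (agree (T ⊛ shift) (U ⊛ shift) p λ k k<n → eq (suc k) (ℕ.s<s k<n)) ⟩
    a · ⟦ U ⟧ (e 0) +ₚ ⟦ U ⟧ (⟦ shift ⟧ p)  ≈⟨ split U ⟨
    ⟦ U ⟧ (a ∷ p)                           ∎
    where
    split : ∀ V → ⟦ V ⟧ (a ∷ p) ≋ a · ⟦ V ⟧ (e 0) +ₚ ⟦ V ⟧ (⟦ shift ⟧ p)
    split V = ≈ᴹ-trans (⟦⟧-cong V (∷-split a p))
      (≈ᴹ-trans (+ᴹ-homo V _ _) (+ᴹ-cong (*ₗ-homo V a (e 0)) ≈ᴹ-refl))

  ext : ∀ {T U} → (∀ k → ⟦ T ⟧ (e k) ≋ ⟦ U ⟧ (e k)) → T ≐ U
  ext {T} {U} eq = pointwise λ p → agree T U p λ k _ → eq k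

  -- A list representing zero may still have entries, all of them zero; `extension-cong` meets this
  -- case when the two lists differ in length.
  extension-[] : ∀ f p → p ≋ [] → linearExtension f p ≋ []
  extension-[] f []      p≋0 = ≈ᴹ-refl
  extension-[] f (a ∷ p) p≋0 = +ᴹ-cong
    (≈ᴹ-trans (*ₗ-cong (coeff≈ p≋0 0) ≈ᴹ-refl) (*ₗ-zeroˡ (f 0)))
    (extension-[] (f ∘ suc) p (coeffwise λ n → coeff≈ p≋0 (suc n)))

  extension-cong : ∀ f p q → p ≋ q → linearExtension f p ≋ linearExtension f q
  extension-cong f []      q       p≋q = ≈ᴹ-sym (extension-[] f q (≈ᴹ-sym p≋q))
  extension-cong f (a ∷ p) []      p≋q = extension-[] f (a ∷ p) p≋q
  extension-cong f (a ∷ p) (b ∷ q) p≋q = +ᴹ-cong (*ₗ-cong (coeff≈ p≋q 0) ≈ᴹ-refl)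
    (extension-cong (f ∘ suc) p q (coeffwise λ n → coeff≈ p≋q (suc n)))

  extension-+ : ∀ f p q → linearExtension f (p +ₚ q) ≋ linearExtension f p +ₚ linearExtension f q
  extension-+ f []      q       = ≈ᴹ-refl
  extension-+ f (a ∷ p) []      = ≈ᴹ-sym (+ᴹ-identityʳ _)
  extension-+ f (a ∷ p) (b ∷ q) = ≈ᴹ-trans
    (+ᴹ-cong (*ₗ-distribʳ (f 0) a b) (extension-+ (f ∘ suc) p q))
    (interchange (a · f 0) (b · f 0) _ _)

  extension-· : ∀ f a p → linearExtension f (a · p) ≋ a · linearExtension f p
  extension-· f a []      = ≈ᴹ-refl
  extension-· f a (b ∷ p) = ≈ᴹ-trans (+ᴹ-cong (*ₗ-assoc a b (f 0)) (extension-· (f ∘ suc) a p))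
    (≈ᴹ-sym (*ₗ-distribˡ a (b · f 0) (linearExtension (f ∘ suc) p)))

  extension : (ℕ → P) → End
  ⟦ extension f ⟧     = linearExtension f
  extension f .linear = mkLinear (λ {p} {q} → extension-cong f p q) (extension-+ f) (extension-· f)

  extension-e : ∀ f n → linearExtension f (e n) ≋ f n
  extension-e f zero    = ≈ᴹ-trans (+ᴹ-identityʳ (1# · f 0)) (*ₗ-identityˡ (f 0))
  extension-e f (suc n) = ≈ᴹ-trans (+ᴹ-cong (*ₗ-zeroˡ (f 0)) (extension-e (f ∘ suc) n)) (+ᴹ-identityˡ (f (suc n)))

  coeff-extension-0 : ∀ f p k → (∀ i → coeff (f i) k ≈ 0#) → coeff (linearExtension f p) k ≈ 0#
  coeff-extension-0 f []      k eq = refl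
  coeff-extension-0 f (a ∷ p) k eq = trans (coeff-+ (a · f 0) _ k) (trans
    (+-cong (trans (coeff-· a (f 0) k) (trans (*-congˡ (eq 0)) (zeroʳ a)))
            (coeff-extension-0 (f ∘ suc) p k (eq ∘ suc)))
    (+-identityˡ 0#))

  coeff-extension : ∀ f p j k → (∀ i → i ≢ j → coeff (f i) k ≈ 0#) →
                    coeff (linearExtension f p) k ≈ coeff p j * coeff (f j) k
  coeff-extension f []      j       k eq = sym (zeroˡ _)
  coeff-extension f (a ∷ p) zero    k eq = trans (coeff-+ (a · f 0) _ k) (trans
    (+-cong (coeff-· a (f 0) k) (coeff-extension-0 (f ∘ suc) p k λ i → eq (suc i) λ ()))
    (+-identityʳ _))
  coeff-extension f (a ∷ p) (suc j) k eq = trans (coeff-+ (a · f 0) _ k) (trans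
    (+-cong (trans (coeff-· a (f 0) k) (trans (*-congˡ (eq 0 λ ())) (zeroʳ a)))
            (coeff-extension (f ∘ suc) p j k λ i i≢j → eq (suc i) (i≢j ∘ ℕ.suc-injective)))
    (+-identityˡ _))

  coeff-e : ∀ n → coeff (e n) n ≈ 1#
  coeff-e zero    = refl
  coeff-e (suc n) = coeff-e n

  coeff-e-≢ : ∀ i n → i ≢ n → coeff (e i) n ≈ 0#
  coeff-e-≢ zero    zero    i≢n = contradiction ≡.refl i≢n
  coeff-e-≢ zero    (suc n) i≢n = refl
  coeff-e-≢ (suc i) zero    i≢n = refl
  coeff-e-≢ (suc i) (suc n) i≢n = coeff-e-≢ i n (i≢n ∘ ≡.cong suc)

  -- The operators ∂ψ and x̂ψ.

  D-image X̂-image : ℕ → P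
  D-image n = [ n ]ψ · e (pred n)
  X̂-image n = (fromℕ (suc n) / [ suc n ]ψ ⟨ [suc n ]ψ#0 ⟩) · e (suc n)

  -- The underlying functions unfold to `∂ψ` and `x̂ψ`, so equations pass between the two forms by
  -- definition.
  D X̂ : End
  D = extension D-image
  X̂ = extension X̂-image

  [0]ψ≈0 : [ 0 ]ψ ≈ 0#
  [0]ψ≈0 = zeroˡ _

  D-e-0 : ⟦ D ⟧ (e 0) ≋ []
  D-e-0 = ≈ᴹ-trans (extension-e D-image 0) (≈ᴹ-trans (*ₗ-cong [0]ψ≈0 ≈ᴹ-refl) (*ₗ-zeroˡ (e 0)))

  D-e-suc : ∀ n → ⟦ D ⟧ (e (suc n)) ≋ [ suc n ]ψ · e n
  D-e-suc n = extension-e D-image (suc n)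

  X̂-e : ∀ n → ⟦ X̂ ⟧ (e n) ≋ (fromℕ (suc n) / [ suc n ]ψ ⟨ [suc n ]ψ#0 ⟩) · e (suc n)
  X̂-e = extension-e X̂-image

  [a/b]*b : ∀ a {b} (b#0 : b # 0#) → (a / b ⟨ b#0 ⟩) * b ≈ a
  [a/b]*b a b#0 = trans (*-assoc a _ _) (trans (*-congˡ (inv-inverseˡ b#0)) (*-identityʳ a))

  -- The denominator in x̂ψ cancels the ψ-number produced by ∂ψ. Thus both products are diagonal,
  -- here with the ordinary number n + 1 and in `X̂D-e` with n, and their difference is the
  -- identity.
  DX̂-e : ∀ n → ⟦ D ⊛ X̂ ⟧ (e n) ≋ fromℕ (suc n) · e n
  DX̂-e n = begin
    ⟦ D ⟧ (⟦ X̂ ⟧ (e n))            ≈⟨ ⟦⟧-cong D (X̂-e n) ⟩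
    ⟦ D ⟧ (b · e (suc n))          ≈⟨ *ₗ-homo D b (e (suc n)) ⟩
    b · ⟦ D ⟧ (e (suc n))          ≈⟨ *ₗ-cong refl (D-e-suc n) ⟩
    b · [ suc n ]ψ · e n           ≈⟨ *ₗ-assoc b [ suc n ]ψ (e n) ⟨
    (b * [ suc n ]ψ) · e n         ≈⟨ *ₗ-cong ([a/b]*b (fromℕ (suc n)) [suc n ]ψ#0) ≈ᴹ-refl ⟩
    fromℕ (suc n) · e n            ∎
    where
    b : Carrier
    b = fromℕ (suc n) / [ suc n ]ψ ⟨ [suc n ]ψ#0 ⟩

  X̂D-e : ∀ n → ⟦ X̂ ⊛ D ⟧ (e n) ≋ fromℕ n · e n
  X̂D-e zero = ≈ᴹ-trans (⟦⟧-cong X̂ D-e-0) (≈ᴹ-sym (*ₗ-zeroˡ (e 0)))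
  X̂D-e (suc n) = begin
    ⟦ X̂ ⟧ (⟦ D ⟧ (e (suc n)))      ≈⟨ ⟦⟧-cong X̂ (D-e-suc n) ⟩
    ⟦ X̂ ⟧ ([ suc n ]ψ · e n)       ≈⟨ *ₗ-homo X̂ [ suc n ]ψ (e n) ⟩
    [ suc n ]ψ · ⟦ X̂ ⟧ (e n)       ≈⟨ *ₗ-cong refl (X̂-e n) ⟩
    [ suc n ]ψ · b · e (suc n)     ≈⟨ *ₗ-assoc [ suc n ]ψ b (e (suc n)) ⟨
    ([ suc n ]ψ * b) · e (suc n)   ≈⟨ *ₗ-cong (trans (*-comm _ b) ([a/b]*b (fromℕ (suc n)) [suc n ]ψ#0)) ≈ᴹ-refl ⟩
    fromℕ (suc n) · e (suc n)      ∎
    where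
    b : Carrier
    b = fromℕ (suc n) / [ suc n ]ψ ⟨ [suc n ]ψ#0 ⟩

  open Derivation X̂

  δ-D : δ D ≐ 1E
  δ-D = δ-unique {D} {1E} (ext λ n → begin
    e n +ₚ ⟦ X̂ ⊛ D ⟧ (e n)      ≈⟨ +ᴹ-cong (≈ᴹ-sym (*ₗ-identityˡ (e n))) (X̂D-e n) ⟩
    1# · e n +ₚ fromℕ n · e n   ≈⟨ *ₗ-distribʳ (e n) 1# (fromℕ n) ⟨
    fromℕ (suc n) · e n         ≈⟨ DX̂-e n ⟨
    ⟦ D ⊛ X̂ ⟧ (e n)             ∎)

  coeff-X̂-0 : ∀ p → coeff (⟦ X̂ ⟧ p) 0 ≈ 0#
  coeff-X̂-0 p = coeff-extension-0 X̂-image p 0 λ i → zeroʳ _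

  coeff-D : ∀ p n → coeff (⟦ D ⟧ p) n ≈ coeff p (suc n) * [ suc n ]ψ
  coeff-D p n = trans (coeff-extension D-image p (suc n) n off-diagonal)
    (*-congˡ (trans (coeff-· [ suc n ]ψ (e n) n) (trans (*-congˡ (coeff-e n)) (*-identityʳ _))))
    where
    off-diagonal : ∀ i → i ≢ suc n → coeff ([ i ]ψ · e (pred i)) n ≈ 0#
    -- Since `pred 0` is `0`, the index 0 would contribute in degree 0; the factor 0_ψ = 0 removes
    -- it.
    off-diagonal zero    _   = trans (coeff-· _ (e 0) n) (trans (*-congʳ [0]ψ≈0) (zeroˡ _))
    off-diagonal (suc i) i≢n = trans (coeff-· _ (e i) n)
      (trans (*-congˡ (coeff-e-≢ i n (i≢n ∘ ≡.cong suc))) (zeroʳ _))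

  -- By `coeff-D` each higher coefficient is killed by some (n+1)_ψ, which is invertible.
  kernel-D : ∀ p → ⟦ D ⟧ p ≋ [] → p ≋ coeff p 0 · e 0
  kernel-D p Dp≋0 = coeffwise λ
    { zero    → sym (*-identityʳ (coeff p 0))
    ; (suc n) → cancel n (trans (sym (coeff-D p n)) (coeff≈ Dp≋0 n))
    }
    where
    cancel : ∀ n → coeff p (suc n) * [ suc n ]ψ ≈ 0# → coeff p (suc n) ≈ 0#
    cancel n eq = trans (sym (trans (*-assoc _ _ _) (trans (*-congˡ (inv-inverseʳ [suc n ]ψ#0)) (*-identityʳ _))))
      (trans (*-congʳ eq) (zeroˡ _))

  D^-e-suc : ∀ k n → ⟦ D ^ suc k ⟧ (e (suc n)) ≋ [ suc n ]ψ · ⟦ D ^ k ⟧ (e n)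
  D^-e-suc k n = begin
    ⟦ D ⊛ D ^ k ⟧ (e (suc n))          ≈⟨ commute-^ {D} {D} ≐-refl k $ᴹ e (suc n) ⟩
    ⟦ D ^ k ⟧ (⟦ D ⟧ (e (suc n)))      ≈⟨ ⟦⟧-cong (D ^ k) (D-e-suc n) ⟩
    ⟦ D ^ k ⟧ ([ suc n ]ψ · e n)       ≈⟨ *ₗ-homo (D ^ k) [ suc n ]ψ (e n) ⟩
    [ suc n ]ψ · ⟦ D ^ k ⟧ (e n)       ∎

  D^-e-< : ∀ {j} k → j ℕ.< k → ⟦ D ^ k ⟧ (e j) ≋ []
  D^-e-< {zero}  (suc k) _         = ≈ᴹ-trans (commute-^ {D} {D} ≐-refl k $ᴹ e 0)
    (≈ᴹ-trans (⟦⟧-cong (D ^ k) D-e-0) (0ᴹ-homo (D ^ k)))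
  D^-e-< {suc j} (suc k) (ℕ.s<s j<k) = ≈ᴹ-trans (D^-e-suc k j) (*ₗ-cong refl (D^-e-< k j<k))

  -- The scalar is the product of 1_ψ, ..., n_ψ, a product of elements apart from zero.
  D^-e : ∀ n → Σ[ a ∈ Carrier ] (a # 0# × ⟦ D ^ n ⟧ (e n) ≋ a · e 0)
  D^-e zero    = 1# , 1#0 , ≈ᴹ-sym (*ₗ-identityˡ (e 0))
  D^-e (suc n) with D^-e n
  ... | a , a#0 , eq = [ suc n ]ψ * a , x#0y#0→xy#0 [suc n ]ψ#0 a#0 ,
    ≈ᴹ-trans (D^-e-suc n n) (≈ᴹ-trans (*ₗ-cong refl eq) (≈ᴹ-sym (*ₗ-assoc [ suc n ]ψ a (e 0))))

  D^-vanish : ∀ k p → length p ℕ.≤ k → ⟦ D ^ k ⟧ p ≋ []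
  D^-vanish k p p≤k = agree (D ^ k) 0E p λ j j<p → D^-e-< k (ℕ.<-≤-trans j<p p≤k)

  -- Finite sums and the operators E^a.

  sum-cong : ∀ n {f g : ℕ → P} → (∀ k → f k ≋ g k) → sumₚ n f ≋ sumₚ n g
  sum-cong zero    eq = ≈ᴹ-refl
  sum-cong (suc n) eq = +ᴹ-cong (sum-cong n eq) (eq n)

  sum-homo : ∀ T n f → ⟦ T ⟧ (sumₚ n f) ≋ sumₚ n (⟦ T ⟧ ∘ f)
  sum-homo T zero    f = 0ᴹ-homo T
  sum-homo T (suc n) f = ≈ᴹ-trans (+ᴹ-homo T _ _) (+ᴹ-cong (sum-homo T n f) ≈ᴹ-refl)

  sum-‿ : ∀ n f g → sumₚ n f -ₚ sumₚ n g ≋ sumₚ n (λ k → f k -ₚ g k)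
  sum-‿ zero    f g = ≈ᴹ-refl
  sum-‿ (suc n) f g = ≈ᴹ-trans (+ᴹ-cong ≈ᴹ-refl (≈ᴹ-sym (⁻¹-∙-comm (sumₚ n g) (g n))))
    (≈ᴹ-trans (interchange (sumₚ n f) (f n) (negₚ (sumₚ n g)) (negₚ (g n))) (+ᴹ-cong (sum-‿ n f g) ≈ᴹ-refl))

  -- `sumₚ` splits off its last term, while Horner evaluation consumes the lowest one first.
  sum-suc : ∀ n f → sumₚ (suc n) f ≋ f 0 +ₚ sumₚ n (f ∘ suc)
  sum-suc zero    f = ≈ᴹ-trans (+ᴹ-identityˡ (f 0)) (≈ᴹ-sym (+ᴹ-identityʳ (f 0)))
  sum-suc (suc n) f = ≈ᴹ-trans (+ᴹ-cong (sum-suc n f) ≈ᴹ-refl) (+ᴹ-assoc (f 0) (sumₚ n (f ∘ suc)) (f (suc n)))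

  sum-extend : ∀ {m n} f → m ℕ.≤ n → (∀ k → m ℕ.≤ k → f k ≋ []) → sumₚ n f ≋ sumₚ m f
  sum-extend {m} {n} f m≤n f≋0 with ℕ.m≤n⇒m<n∨m≡n m≤n
  ... | inj₂ ≡.refl = ≈ᴹ-refl
  sum-extend {m} {suc n} f _ f≋0 | inj₁ (ℕ.s<s m≤n) =
    ≈ᴹ-trans (+ᴹ-cong (sum-extend f m≤n f≋0) (f≋0 n m≤n)) (+ᴹ-identityʳ _)

  sum-horner : ∀ n (v : ℕ → P) a → sumₚ n (λ k → (a ^ₖ k) · v k) ≋ horner (tabulate {n = n} (v ∘ toℕ)) a
  sum-horner zero    v a = ≈ᴹ-refl
  sum-horner (suc n) v a = ≈ᴹ-trans (sum-suc n _) (+ᴹ-cong (*ₗ-identityˡ (v 0)) (begin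
    sumₚ n (λ k → (a * a ^ₖ k) · v (suc k))   ≈⟨ sum-cong n (λ k → *ₗ-assoc a (a ^ₖ k) (v (suc k))) ⟩
    sumₚ n (λ k → a · (a ^ₖ k) · v (suc k))   ≈⟨ sum-homo (homothety a) n _ ⟨
    a · sumₚ n (λ k → (a ^ₖ k) · v (suc k))   ≈⟨ *ₗ-cong refl (sum-horner n (v ∘ suc) a) ⟩
    a · horner (tabulate {n = n} (v ∘ suc ∘ toℕ)) a   ∎))

  1/[_]ψ! : ℕ → Carrier
  1/[ k ]ψ! = inv [ k ]ψ! [ k ]ψ!#0

  E-weight : Carrier → ℕ → Carrier
  E-weight a k = (a ^ₖ k) / [ k ]ψ! ⟨ [ k ]ψ!#0 ⟩

  -- The cut-off in `E` depends on the list, but further powers of ∂ψ kill `p`. A free upper bound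
  -- allows sums at `p` and at `T p` to run over the same range.
  E-sum : ∀ a p {n} → length p ℕ.≤ n → E a p ≋ sumₚ n (λ k → E-weight a k · ⟦ D ^ k ⟧ p)
  E-sum a p p≤n = ≈ᴹ-trans
    (sum-cong (length p) λ k → *ₗ-cong refl (≈ᴹ-reflexive (≡.sym (^-apply D k p))))
    (≈ᴹ-sym (sum-extend (λ k → E-weight a k · ⟦ D ^ k ⟧ p) p≤n λ k p≤k → *ₗ-cong refl (D^-vanish k p p≤k)))

  homo-E : ∀ T a p {n} → length p ℕ.≤ n →
           ⟦ T ⟧ (E a p) ≋ sumₚ n (λ k → E-weight a k · ⟦ T ⟧ (⟦ D ^ k ⟧ p))
  homo-E T a p {n} p≤n = ≈ᴹ-trans (⟦⟧-cong T (E-sum a p p≤n)) (≈ᴹ-trans (sum-homo T n (λ k → E-weight a k · ⟦ D ^ k ⟧ p))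
    (sum-cong n λ k → *ₗ-homo T (E-weight a k) (⟦ D ^ k ⟧ p)))

  -- The algebra Σψ as the centralizer of ∂ψ.

  commute⇒inΣψ : ∀ T → Commute D T → InΣψ ⟦ T ⟧
  commute⇒inΣψ T DT = record
    { linear   = isLinear T
    ; commutes = λ a p → coeff≈ (≈ᴹ-trans (homo-E T a p (ℕ.m≤m⊔n (length p) (length (⟦ T ⟧ p))))
        (≈ᴹ-trans (sum-cong (length p ℕ.⊔ length (⟦ T ⟧ p)) λ k →
            *ₗ-cong refl (commute-^ {T} {D} (≐-sym DT) k $ᴹ p))
          (≈ᴹ-sym (E-sum a (⟦ T ⟧ p) (ℕ.m≤n⊔m (length p) (length (⟦ T ⟧ p)))))))
    }

  module _ (T : End) (p : P) where

    -- The coefficient of `a ^ k` in `T (E a p) - E a (T p)`, regarded as a polynomial in `a` with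
    -- coefficients in F[x].
    E-commutator-coeff : ℕ → P
    E-commutator-coeff k = 1/[ k ]ψ! · (⟦ T ⟧ (⟦ D ^ k ⟧ p) -ₚ ⟦ D ^ k ⟧ (⟦ T ⟧ p))

    E-commutator : ∀ {n} → length p ℕ.≤ n → length (⟦ T ⟧ p) ℕ.≤ n → ∀ a →
      horner (tabulate {n = n} (E-commutator-coeff ∘ toℕ)) a ≋ ⟦ T ⟧ (E a p) -ₚ E a (⟦ T ⟧ p)
    E-commutator {n} p≤n Tp≤n a = begin
      horner (tabulate {n = n} (E-commutator-coeff ∘ toℕ)) a
        ≈⟨ sum-horner n E-commutator-coeff a ⟨
      sumₚ n (λ k → (a ^ₖ k) · E-commutator-coeff k)
        ≈⟨ sum-cong n term ⟩
      sumₚ n (λ k → f k -ₚ g k)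
        ≈⟨ sum-‿ n f g ⟨
      sumₚ n f -ₚ sumₚ n g
        ≈⟨ +ᴹ-cong (≈ᴹ-sym (homo-E T a p p≤n)) (-ᴹ‿cong (≈ᴹ-sym (E-sum a (⟦ T ⟧ p) Tp≤n))) ⟩
      ⟦ T ⟧ (E a p) -ₚ E a (⟦ T ⟧ p) ∎
      where
      f g : ℕ → P
      f k = E-weight a k · ⟦ T ⟧ (⟦ D ^ k ⟧ p)
      g k = E-weight a k · ⟦ D ^ k ⟧ (⟦ T ⟧ p)

      term : ∀ k → (a ^ₖ k) · E-commutator-coeff k ≋ f k -ₚ g k
      term k = begin
        (a ^ₖ k) · 1/[ k ]ψ! · (x -ₚ y)                ≈⟨ *ₗ-assoc (a ^ₖ k) 1/[ k ]ψ! (x -ₚ y) ⟨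
        E-weight a k · (x -ₚ y)                        ≈⟨ *ₗ-distribˡ (E-weight a k) x (negₚ y) ⟩
        E-weight a k · x +ₚ E-weight a k · negₚ y      ≈⟨ +ᴹ-cong ≈ᴹ-refl (-ᴹ-scale (E-weight a k) y) ⟩
        f k -ₚ g k                                     ∎
        where
        x y : P
        x = ⟦ T ⟧ (⟦ D ^ k ⟧ p)
        y = ⟦ D ^ k ⟧ (⟦ T ⟧ p)

  E-commuting⇒commute : CharacteristicZero F → ∀ T → (∀ a p → ⟦ T ⟧ (E a p) ≋ E a (⟦ T ⟧ p)) → Commute D T
  E-commuting⇒commute charZero T TE≋ET = pointwise λ p → ≈ᴹ-sym (x∙y⁻¹≈ε⇒x≈y _ _ (commutator≋0 p))
    where
    entry₁ : ∀ {n} (v : ℕ → P) → 2 ℕ.≤ n → AllZero (tabulate {n = n} (v ∘ toℕ)) → v 1 ≋ []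
    entry₁ v (ℕ.s≤s (ℕ.s≤s _)) (_ ∷ v₁≋0 ∷ _) = v₁≋0

    all-zero : ∀ p {n} → length p ℕ.≤ n → length (⟦ T ⟧ p) ℕ.≤ n →
               AllZero (tabulate {n = n} (E-commutator-coeff T p ∘ toℕ))
    all-zero p p≤n Tp≤n = vanishing charZero (tabulate (E-commutator-coeff T p ∘ toℕ)) 0 λ i →
      ≈ᴹ-trans (E-commutator T p p≤n Tp≤n (fromℕ i)) (x≈y⇒x∙y⁻¹≈ε (TE≋ET (fromℕ i) p))

    commutator≋0 : ∀ p → ⟦ T ⟧ (⟦ D ⟧ p) -ₚ ⟦ D ⟧ (⟦ T ⟧ p) ≋ []
    -- The entry at index 1 is the commutator times the unit `1/[ 1 ]ψ!`. The summand 2 in the bound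
    -- ensures that this entry exists even for short lists.
    commutator≋0 p = *ₗ-cancel-0 (inv#0 [ 1 ]ψ! [ 1 ]ψ!#0) (entry₁ (E-commutator-coeff T p)
      (ℕ.m≤m+n 2 (length p ℕ.+ length (⟦ T ⟧ p)))
      (all-zero p (ℕ.m≤n⇒m≤o+n 2 (ℕ.m≤m+n (length p) _)) (ℕ.m≤n⇒m≤o+n 2 (ℕ.m≤n+m _ (length p)))))

  inΣψ⇒commute : CharacteristicZero F → ∀ {T} (T∈Σ : InΣψ T) → Commute D (toEnd (InΣψ.linear T∈Σ))
  inΣψ⇒commute charZero T∈Σ = E-commuting⇒commute charZero (toEnd (InΣψ.linear T∈Σ)) λ a p →
    coeffwise (InΣψ.commutes T∈Σ a p)

  -- Commutativity of the centralizer.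

  -- R is a polynomial in D, of which only the commutation property is recorded.
  approximation : ∀ {T} → Commute D T → ∀ n →
    Σ[ R ∈ End ] ((∀ {U} → Commute D U → Commute U R) × (∀ k → k ℕ.< n → ⟦ T ⟧ (e k) ≋ ⟦ R ⟧ (e k)))
  approximation DT zero = 0E , (λ {U} _ → commute-0 U) , λ _ ()
  approximation {T} DT (suc n) with approximation DT n | D^-e n
  ... | R , central , T≋R | a , a#0 , D^ne≋ae = R′ , central′ , T≋R′
    where
    A : End
    A = T ⊕ ⊖ R

    DA : Commute D A
    DA = commute-+ {D} {T} {⊖ R} DT (commute-‿ {D} {R} (central {D} ≐-refl))

    A-e : ∀ k → k ℕ.< n → ⟦ A ⟧ (e k) ≋ []
    A-e k k<n = x≈y⇒x∙y⁻¹≈ε (T≋R k k<n)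

    DA-e : ∀ m → (∀ k → k ℕ.< m → ⟦ A ⟧ (e k) ≋ []) → ⟦ A ⟧ (⟦ D ⟧ (e m)) ≋ []
    DA-e zero    _   = ≈ᴹ-trans (⟦⟧-cong A D-e-0) (0ᴹ-homo A)
    DA-e (suc m) A≋0 = ≈ᴹ-trans (⟦⟧-cong A (D-e-suc m))
      (≈ᴹ-trans (*ₗ-homo A [ suc m ]ψ (e m)) (*ₗ-cong refl (A≋0 m ℕ.≤-refl)))

    -- The error `A` commutes with ∂ψ and kills the lower monomials, so it sends xⁿ into ker ∂ψ, to
    -- a constant `b`. Since ∂ψⁿ xⁿ is the constant `a`, the correction is `b / a` times ∂ψⁿ, which
    -- leaves lower degrees untouched.
    b w : Carrier
    b = coeff (⟦ A ⟧ (e n)) 0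
    w = b / a ⟨ a#0 ⟩

    A-e-n : ⟦ A ⟧ (e n) ≋ b · e 0
    A-e-n = kernel-D _ (≈ᴹ-trans (DA $ᴹ e n) (DA-e n A-e))

    R′ : End
    R′ = homothety w ⊛ D ^ n ⊕ R

    central′ : ∀ {U} → Commute D U → Commute U R′
    central′ {U} DU = commute-+ {U} {homothety w ⊛ D ^ n} {R}
      (commute-* {U} {homothety w} {D ^ n} (≐-sym (homothety-commute w U)) (commute-^ {U} {D} (≐-sym DU) n))
      (central {U} DU)

    A≋ : ∀ k → k ℕ.< suc n → ⟦ A ⟧ (e k) ≋ w · ⟦ D ^ n ⟧ (e k)
    A≋ k (ℕ.s≤s k≤n) with ℕ.m≤n⇒m<n∨m≡n k≤n
    ... | inj₁ k<n    = ≈ᴹ-trans (A-e k k<n) (*ₗ-cong refl (≈ᴹ-sym (D^-e-< n k<n)))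
    ... | inj₂ ≡.refl = begin
      ⟦ A ⟧ (e n)           ≈⟨ A-e-n ⟩
      b · e 0               ≈⟨ *ₗ-cong ([a/b]*b b a#0) ≈ᴹ-refl ⟨
      (w * a) · e 0         ≈⟨ *ₗ-assoc w a (e 0) ⟩
      w · a · e 0           ≈⟨ *ₗ-cong refl D^ne≋ae ⟨
      w · ⟦ D ^ n ⟧ (e n)   ∎

    T≋R′ : ∀ k → k ℕ.< suc n → ⟦ T ⟧ (e k) ≋ ⟦ R′ ⟧ (e k)
    T≋R′ k k<1+n = ≈ᴹ-trans (≈ᴹ-sym (//-rightDividesˡ (⟦ R ⟧ (e k)) (⟦ T ⟧ (e k)))) (+ᴹ-cong (A≋ k k<1+n) ≈ᴹ-refl)

  -- At a fixed `p` the operator `T` meets only `p` and `U p`; one approximation up to the larger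
  -- length replaces it in both places.
  centralizer-commutative : ∀ {T U} → Commute D T → Commute D U → Commute T U
  centralizer-commutative {T} {U} DT DU = pointwise commute
    where
    commute : ∀ p → ⟦ T ⟧ (⟦ U ⟧ p) ≋ ⟦ U ⟧ (⟦ T ⟧ p)
    commute p with approximation DT (length p ℕ.⊔ length (⟦ U ⟧ p))
    ... | R , central , T≋R = begin
      ⟦ T ⟧ (⟦ U ⟧ p)  ≈⟨ agree T R (⟦ U ⟧ p) (λ k k< → T≋R k (ℕ.<-≤-trans k< (ℕ.m≤n⊔m (length p) _))) ⟩
      ⟦ R ⟧ (⟦ U ⟧ p)  ≈⟨ central {U} DU $ᴹ p ⟨
      ⟦ U ⟧ (⟦ R ⟧ p)  ≈⟨ ⟦⟧-cong U (agree T R p (λ k k< → T≋R k (ℕ.<-≤-trans k< (ℕ.m≤m⊔n (length p) _)))) ⟨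
      ⟦ U ⟧ (⟦ T ⟧ p)  ∎

  -- Locally finite geometric series.

  -- A pointwise limit: at each polynomial the family is eventually constant, so each law of
  -- linearity is inherited from a single `A n` with `n` above all lengths involved.
  glue : (A : ℕ → End) → (∀ p {n} → length p ℕ.≤ n → ⟦ A n ⟧ p ≋ ⟦ A (length p) ⟧ p) → End
  ⟦ glue A stable ⟧ p = ⟦ A (length p) ⟧ p
  glue A stable .linear = mkLinear
    (λ {p} {q} p≋q → let n = length p ℕ.⊔ length q in begin
      ⟦ A (length p) ⟧ p  ≈⟨ stable p (ℕ.m≤m⊔n (length p) (length q)) ⟨
      ⟦ A n ⟧ p           ≈⟨ ⟦⟧-cong (A n) p≋q ⟩
      ⟦ A n ⟧ q           ≈⟨ stable q (ℕ.m≤n⊔m (length p) (length q)) ⟩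
      ⟦ A (length q) ⟧ q  ∎)
    (λ p q → let m = length p ℕ.⊔ length q ; l = length (p +ₚ q) ; n = l ℕ.⊔ m in begin
      ⟦ A l ⟧ (p +ₚ q)
        ≈⟨ stable (p +ₚ q) (ℕ.m≤m⊔n l m) ⟨
      ⟦ A n ⟧ (p +ₚ q)
        ≈⟨ +ᴹ-homo (A n) p q ⟩
      ⟦ A n ⟧ p +ₚ ⟦ A n ⟧ q
        ≈⟨ +ᴹ-cong (stable p (ℕ.m≤n⇒m≤o⊔n l (ℕ.m≤m⊔n (length p) (length q))))
                   (stable q (ℕ.m≤n⇒m≤o⊔n l (ℕ.m≤n⊔m (length p) (length q)))) ⟩
      ⟦ A (length p) ⟧ p +ₚ ⟦ A (length q) ⟧ q ∎)
    (λ a p → let n = length (a · p) ℕ.⊔ length p in begin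
      ⟦ A (length (a · p)) ⟧ (a · p)  ≈⟨ stable (a · p) (ℕ.m≤m⊔n (length (a · p)) (length p)) ⟨
      ⟦ A n ⟧ (a · p)                 ≈⟨ *ₗ-homo (A n) a p ⟩
      a · ⟦ A n ⟧ p                   ≈⟨ *ₗ-cong refl (stable p (ℕ.m≤n⊔m (length (a · p)) (length p))) ⟩
      a · ⟦ A (length p) ⟧ p          ∎)

  module Neumann {k : End} (Dk : Commute D k)
                 (nilpotent : ∀ n p → length p ℕ.≤ n → ⟦ k ^ n ⟧ p ≋ []) where

    stable : ∀ p {n} → length p ℕ.≤ n → ⟦ geometric k n ⟧ p ≋ ⟦ geometric k (length p) ⟧ p
    stable p {n} p≤n with ℕ.m≤n⇒m<n∨m≡n p≤n
    ... | inj₂ eq = ≈ᴹ-reflexive (≡.cong (λ j → ⟦ geometric k j ⟧ p) (≡.sym eq))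
    stable p {suc n} _ | inj₁ (ℕ.s<s p≤n) =
      ≈ᴹ-trans (+ᴹ-cong (stable p p≤n) (nilpotent n p p≤n)) (+ᴹ-identityʳ _)

    neumann : End
    neumann = glue (geometric k) stable

    D-neumann : Commute D neumann
    D-neumann = pointwise λ p → let n = length p ℕ.⊔ length (⟦ D ⟧ p) in begin
      ⟦ D ⟧ (⟦ neumann ⟧ p)        ≈⟨ ⟦⟧-cong D (stable p (ℕ.m≤m⊔n (length p) _)) ⟨
      ⟦ D ⟧ (⟦ geometric k n ⟧ p)  ≈⟨ commute-geometric {D} {k} Dk n $ᴹ p ⟩
      ⟦ geometric k n ⟧ (⟦ D ⟧ p)  ≈⟨ stable (⟦ D ⟧ p) (ℕ.m≤n⊔m (length p) _) ⟩
      ⟦ neumann ⟧ (⟦ D ⟧ p)        ∎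

    neumann-inverseʳ : (1E ⊕ ⊖ k) ⊛ neumann ≐ 1E
    neumann-inverseʳ = pointwise λ p → begin
      ⟦ (1E ⊕ ⊖ k) ⊛ neumann ⟧ p
        ≈⟨ +ᴹ-identityʳ _ ⟨
      ⟦ (1E ⊕ ⊖ k) ⊛ neumann ⟧ p +ₚ []
        -- The added zero is the remainder of the telescoping sum at `p`.
        ≈⟨ +ᴹ-cong ≈ᴹ-refl (nilpotent (length p) p ℕ.≤-refl) ⟨
      ⟦ (1E ⊕ ⊖ k) ⊛ geometric k (length p) ⊕ k ^ length p ⟧ p
        ≈⟨ [1-k]*geometric k (length p) $ᴹ p ⟩
      p ∎

    -- Both factors lie in the centralizer of ∂ψ, where they commute, so the right inverse is also a
    -- left inverse.
    neumann-inverseˡ : neumann ⊛ (1E ⊕ ⊖ k) ≐ 1E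
    neumann-inverseˡ = ≐-trans (centralizer-commutative {neumann} {1E ⊕ ⊖ k} D-neumann
      (commute-+ {D} {1E} {⊖ k} (commute-1 D) (commute-‿ {D} {k} Dk))) neumann-inverseʳ

  -- Carries linearity over to a bare function known only by its values, as `pincherle Q` is known
  -- through `q′`.
  replace : ∀ U {T : P → P} → (∀ p → T p ≋ ⟦ U ⟧ p) → End
  ⟦ replace U {T} T≋U ⟧ = T
  replace U T≋U .linear = mkLinear
    (λ {p} {q} p≋q → ≈ᴹ-trans (T≋U p) (≈ᴹ-trans (⟦⟧-cong U p≋q) (≈ᴹ-sym (T≋U q))))
    (λ p q → ≈ᴹ-trans (T≋U (p +ₚ q)) (≈ᴹ-trans (+ᴹ-homo U p q) (≈ᴹ-sym (+ᴹ-cong (T≋U p) (T≋U q)))))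
    (λ a p → ≈ᴹ-trans (T≋U (a · p)) (≈ᴹ-trans (*ₗ-homo U a p) (≈ᴹ-sym (*ₗ-cong refl (T≋U p)))))

  inΣψ-resp : ∀ U {T : P → P} → (∀ p → T p ≋ ⟦ U ⟧ p) → Commute D U → InΣψ T
  inΣψ-resp U T≋U DU = commute⇒inΣψ (replace U T≋U) (pointwise λ p →
    ≈ᴹ-trans (⟦⟧-cong D (T≋U p)) (≈ᴹ-trans (DU $ᴹ p) (≈ᴹ-sym (T≋U (⟦ D ⟧ p)))))

  eval-0 : ∀ p → eval p 0# ≈ coeff p 0
  eval-0 []      = refl
  eval-0 (a ∷ p) = trans (+-congˡ (zeroˡ (eval p 0#))) (+-identityʳ a)

  -- Invertibility of the Pincherle derivative Q'.

  module BasicSequence (charZero : CharacteristicZero F) {Q S : P → P} {p : ℕ → P}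
      (S-invertible : InvertibleInΣψ S) (Q≗∂S : Q ≗ₚ ∂ψ ∘ S) (basic : IsBasicSequence Q p) where

    module S-inv = InvertibleInΣψ S-invertible
    module basic = IsBasicSequence basic

    s r q q′ : End
    s  = toEnd (InΣψ.linear S-inv.inΣψ)
    r  = toEnd (InΣψ.linear S-inv.inverseInΣψ)
    q  = D ⊛ s
    q′ = δ q

    Ds : Commute D s
    Ds = inΣψ⇒commute charZero S-inv.inΣψ

    Dr : Commute D r
    Dr = inΣψ⇒commute charZero S-inv.inverseInΣψ

    sr≐1 : s ⊛ r ≐ 1E
    sr≐1 = pointwise λ u → coeffwise (S-inv.inverseʳ u)

    rs≐1 : r ⊛ s ≐ 1E
    rs≐1 = pointwise λ u → coeffwise (S-inv.inverseˡ u)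

    Dδs : Commute D (δ s)
    Dδs = δ-commute {D} {s} δ-D Ds

    rδs : Commute r (δ s)
    rδs = centralizer-commutative {r} {δ s} Dr Dδs

    Dq : Commute D q
    Dq = commute-* {D} {D} {s} ≐-refl Ds

    Dq′ : Commute D q′
    Dq′ = δ-commute {D} {q} δ-D Dq

    Q≋q : ∀ u → Q u ≋ ⟦ q ⟧ u
    Q≋q u = coeffwise (Q≗∂S u)

    Q′≋q′ : ∀ u → pincherle Q u ≋ ⟦ q′ ⟧ u
    Q′≋q′ u = +ᴹ-cong (Q≋q (⟦ X̂ ⟧ u)) (-ᴹ‿cong (⟦⟧-cong X̂ (Q≋q u)))

    -- Chosen so that Q' = S (1 - k); its factor ∂ψ makes the geometric series locally finite.
    k : End
    k = ⊖ (r ⊛ δ s) ⊛ D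

    Dk : Commute D k
    Dk = commute-* {D} {⊖ (r ⊛ δ s)} {D}
      (commute-‿ {D} {r ⊛ δ s} (commute-* {D} {r} {δ s} Dr Dδs)) ≐-refl

    -- The two factors of `k` commute, so its n-th power ends in ∂ψⁿ, which already kills `u`.
    k-nilpotent : ∀ n u → length u ℕ.≤ n → ⟦ k ^ n ⟧ u ≋ []
    k-nilpotent n u u≤n = ≈ᴹ-trans
      (^-distrib-* {g} {D} (≐-sym (commute-‿ {D} {r ⊛ δ s} (commute-* {D} {r} {δ s} Dr Dδs))) n $ᴹ u)
      (≈ᴹ-trans (⟦⟧-cong (g ^ n) (D^-vanish n u u≤n)) (0ᴹ-homo (g ^ n)))
      where
      g : End
      g = ⊖ (r ⊛ δ s)

    open Neumann Dk k-nilpotent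

    q′-factorization : s ⊛ (1E ⊕ ⊖ k) ≐ q′
    q′-factorization = ≐-trans (unit-factorization {D} {s} {r} {δ s} sr≐1 Dδs)
      (≐-sym (δ-ds {s} {r} sr≐1 rs≐1 rδs {D} δ-D (≐-sym Dr)))

    q′⁻¹ : End
    q′⁻¹ = neumann ⊛ r

    q′⁻¹-inverseˡ : ∀ u → ⟦ q′⁻¹ ⟧ (⟦ q′ ⟧ u) ≋ u
    q′⁻¹-inverseˡ u = begin
      ⟦ q′⁻¹ ⟧ (⟦ q′ ⟧ u)                        ≈⟨ ⟦⟧-cong q′⁻¹ (q′-factorization $ᴹ u) ⟨
      ⟦ neumann ⟧ (⟦ r ⟧ (⟦ s ⟧ (⟦ 1E ⊕ ⊖ k ⟧ u)))  ≈⟨ ⟦⟧-cong neumann (rs≐1 $ᴹ ⟦ 1E ⊕ ⊖ k ⟧ u) ⟩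
      ⟦ neumann ⟧ (⟦ 1E ⊕ ⊖ k ⟧ u)               ≈⟨ neumann-inverseˡ $ᴹ u ⟩
      u                                          ∎

    q′⁻¹-inverseʳ : ∀ u → ⟦ q′ ⟧ (⟦ q′⁻¹ ⟧ u) ≋ u
    q′⁻¹-inverseʳ u = begin
      ⟦ q′ ⟧ (⟦ q′⁻¹ ⟧ u)                        ≈⟨ q′-factorization $ᴹ ⟦ q′⁻¹ ⟧ u ⟨
      ⟦ s ⟧ (⟦ (1E ⊕ ⊖ k) ⊛ neumann ⟧ (⟦ r ⟧ u))   ≈⟨ ⟦⟧-cong s (neumann-inverseʳ $ᴹ ⟦ r ⟧ u) ⟩
      ⟦ s ⟧ (⟦ r ⟧ u)                            ≈⟨ sr≐1 $ᴹ u ⟩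
      u                                          ∎

    Q′-invertible : InvertibleInΣψ (pincherle Q)
    Q′-invertible = record
      { inΣψ        = inΣψ-resp q′ Q′≋q′ Dq′
      ; inverse     = ⟦ q′⁻¹ ⟧
      ; inverseInΣψ = commute⇒inΣψ q′⁻¹ (commute-* {D} {neumann} {r} D-neumann Dr)
      ; inverseˡ    = λ u → coeff≈ (≈ᴹ-trans (⟦⟧-cong q′⁻¹ (Q′≋q′ u)) (q′⁻¹-inverseˡ u))
      ; inverseʳ    = λ u → coeff≈ (≈ᴹ-trans (Q′≋q′ (⟦ q′⁻¹ ⟧ u)) (q′⁻¹-inverseʳ u))
      }

    -- The polynomials of the transfer formula and their identification with pₙ.

    f : ℕ → P
    f n = ⟦ q′ ⊛ r ^ suc n ⟧ (e n)

    f-expand : ∀ n → f n ≋ ⟦ r ^ n ⟧ (e n) +ₚ ⟦ δ s ⊛ r ^ suc n ⟧ (⟦ D ⟧ (e n))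
    f-expand n = δ-ds*r^ {s} {r} sr≐1 rs≐1 rδs {D} δ-D (≐-sym Dr) Dδs n $ᴹ e n

    f-0 : f 0 ≋ e 0
    f-0 = ≈ᴹ-trans (f-expand 0) (≈ᴹ-trans
      (+ᴹ-cong (≈ᴹ-refl {e 0}) (≈ᴹ-trans (⟦⟧-cong (δ s ⊛ r ^ 1) D-e-0) (0ᴹ-homo (δ s ⊛ r ^ 1))))
      (+ᴹ-identityʳ (e 0)))

    -- The factor n_ψ / n of the formulas at n = m + 1, inverse to the weight of x̂ψ on xᵐ.
    α : ℕ → Carrier
    α m = [ suc m ]ψ / fromℕ (suc m) ⟨ charZero (suc m) ⟩

    αX̂-e : ∀ m → α m · ⟦ X̂ ⟧ (e m) ≋ e (suc m)
    αX̂-e m = begin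
      α m · ⟦ X̂ ⟧ (e m)                  ≈⟨ *ₗ-cong refl (X̂-e m) ⟩
      α m · (fromℕ (suc m) * w) · e (suc m)    ≈⟨ *ₗ-assoc (α m) (fromℕ (suc m) * w) (e (suc m)) ⟨
      (α m * (fromℕ (suc m) * w)) · e (suc m)  ≈⟨ *ₗ-cong α*w≈1 ≈ᴹ-refl ⟩
      1# · e (suc m)                     ≈⟨ *ₗ-identityˡ (e (suc m)) ⟩
      e (suc m)                          ∎
      where
      w : Carrier
      w = inv [ suc m ]ψ [suc m ]ψ#0

      α*w≈1 : α m * (fromℕ (suc m) * w) ≈ 1#
      α*w≈1 = trans (sym (*-assoc (α m) (fromℕ (suc m)) w))
        (trans (*-congʳ ([a/b]*b [ suc m ]ψ (charZero (suc m)))) (inv-inverseʳ [suc m ]ψ#0))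

    -- Writing xⁿ as `α m` times x̂ψ xᵐ turns ∂ψ xⁿ into a multiple of xᵐ with the factor n, where n
    -- = m + 1. The second term then becomes exactly the correction that moves x̂ψ to the left of
    -- S⁻ⁿ.
    f-suc : ∀ m → f (suc m) ≋ α m · ⟦ X̂ ⟧ (⟦ r ^ suc m ⟧ (e m))
    f-suc m = begin
      f n
        ≈⟨ f-expand n ⟩
      ⟦ r ^ n ⟧ (e n) +ₚ ⟦ t ⟧ (⟦ D ⟧ (e n))
        ≈⟨ +ᴹ-cong (scale-out (r ^ n)) (scale-out (t ⊛ D)) ⟩
      α m · v +ₚ α m · ⟦ t ⟧ (⟦ D ⊛ X̂ ⟧ (e m))
        ≈⟨ *ₗ-distribˡ (α m) v (⟦ t ⟧ (⟦ D ⊛ X̂ ⟧ (e m))) ⟨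
      α m · (v +ₚ ⟦ t ⟧ (⟦ D ⊛ X̂ ⟧ (e m)))
        ≈⟨ *ₗ-cong refl (+ᴹ-cong (≈ᴹ-refl {v}) (⟦⟧-cong t (DX̂-e m))) ⟩
      α m · (v +ₚ ⟦ t ⟧ (fromℕ n · e m))
        ≈⟨ *ₗ-cong refl (+ᴹ-cong (≈ᴹ-refl {v}) (≈ᴹ-trans (*ₗ-homo t (fromℕ n) (e m)) (≈ᴹ-sym (·ℕ-apply n t (e m))))) ⟩
      α m · ⟦ r ^ n ⊛ X̂ ⊕ n ·ℕ t ⟧ (e m)
        ≈⟨ *ₗ-cong refl (r^n*x+nδsr^[1+n]≈x*r^n {s} {r} sr≐1 rs≐1 rδs n $ᴹ e m) ⟩
      α m · ⟦ X̂ ⟧ (⟦ r ^ n ⟧ (e m)) ∎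
      where
      n : ℕ
      n = suc m

      v : P
      v = ⟦ r ^ n ⟧ (⟦ X̂ ⟧ (e m))

      t : End
      t = δ s ⊛ r ^ suc n

      scale-out : ∀ T → ⟦ T ⟧ (e n) ≋ α m · ⟦ T ⟧ (⟦ X̂ ⟧ (e m))
      scale-out T = ≈ᴹ-trans (⟦⟧-cong T (≈ᴹ-sym (αX̂-e m))) (*ₗ-homo T (α m) _)

    -- Passes from (3) to (2): moving x̂ψ back to the right of S⁻ⁿ costs the derivative of S⁻ⁿ.
    x̂S⁻ⁿ-pincherle : ∀ m →
      α m · ⟦ X̂ ⟧ (⟦ r ^ suc m ⟧ (e m)) ≋ ⟦ r ^ suc m ⟧ (e (suc m)) -ₚ α m · ⟦ δ (r ^ suc m) ⟧ (e m)
    x̂S⁻ⁿ-pincherle m = x≈z//y _ _ _ (begin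
      α m · ⟦ X̂ ⊛ R ⟧ (e m) +ₚ α m · ⟦ δ R ⟧ (e m)  ≈⟨ +ᴹ-comm (α m · ⟦ X̂ ⊛ R ⟧ (e m)) (α m · ⟦ δ R ⟧ (e m)) ⟩
      α m · ⟦ δ R ⟧ (e m) +ₚ α m · ⟦ X̂ ⊛ R ⟧ (e m)  ≈⟨ *ₗ-distribˡ (α m) (⟦ δ R ⟧ (e m)) (⟦ X̂ ⊛ R ⟧ (e m)) ⟨
      α m · ⟦ δ R ⊕ X̂ ⊛ R ⟧ (e m)                   ≈⟨ *ₗ-cong refl (δ-spec R $ᴹ e m) ⟩
      α m · ⟦ R ⟧ (⟦ X̂ ⟧ (e m))                     ≈⟨ *ₗ-homo R (α m) (⟦ X̂ ⟧ (e m)) ⟨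
      ⟦ R ⟧ (α m · ⟦ X̂ ⟧ (e m))                     ≈⟨ ⟦⟧-cong R (αX̂-e m) ⟩
      ⟦ R ⟧ (e (suc m))                             ∎)
      where
      R : End
      R = r ^ suc m

    -- Q moves past Q', its factor S cancels one S⁻¹, and ∂ψ passes the remaining powers to reach
    -- the monomial.
    q-f : ∀ n → ⟦ q ⟧ (f (suc n)) ≋ [ suc n ]ψ · f n
    q-f n = begin
      ⟦ q ⟧ (⟦ q′ ⟧ (⟦ r ⟧ v))           ≈⟨ centralizer-commutative {q} {q′} Dq Dq′ $ᴹ ⟦ r ⟧ v ⟩
      ⟦ q′ ⟧ (⟦ D ⟧ (⟦ s ⟧ (⟦ r ⟧ v)))    ≈⟨ ⟦⟧-cong q′ (⟦⟧-cong D (sr≐1 $ᴹ v)) ⟩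
      ⟦ q′ ⟧ (⟦ D ⟧ (⟦ R ⟧ (e (suc n)))) ≈⟨ ⟦⟧-cong q′ (commute-^ {D} {r} Dr (suc n) $ᴹ e (suc n)) ⟩
      ⟦ q′ ⊛ R ⟧ (⟦ D ⟧ (e (suc n)))     ≈⟨ ⟦⟧-cong (q′ ⊛ R) (D-e-suc n) ⟩
      ⟦ q′ ⊛ R ⟧ ([ suc n ]ψ · e n)      ≈⟨ *ₗ-homo (q′ ⊛ R) [ suc n ]ψ (e n) ⟩
      [ suc n ]ψ · f n                   ∎
      where
      R : End
      R = r ^ suc n

      v : P
      v = ⟦ R ⟧ (e (suc n))

    -- S⁻¹ strips the invertible factor from Q, which leaves ker ∂ψ, the constants.
    kernel-q : ∀ u → ⟦ q ⟧ u ≋ [] → coeff u 0 ≈ 0# → u ≋ []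
    kernel-q u qu≋0 u₀≈0 = ≈ᴹ-trans (kernel-D u Du≋0) (≈ᴹ-trans (*ₗ-cong u₀≈0 ≈ᴹ-refl) (*ₗ-zeroˡ (e 0)))
      where
      Du≋0 : ⟦ D ⟧ u ≋ []
      Du≋0 = begin
        ⟦ D ⟧ u                      ≈⟨ rs≐1 $ᴹ ⟦ D ⟧ u ⟨
        ⟦ r ⟧ (⟦ s ⟧ (⟦ D ⟧ u))      ≈⟨ ⟦⟧-cong r (Ds $ᴹ u) ⟨
        ⟦ r ⟧ (⟦ q ⟧ u)              ≈⟨ ⟦⟧-cong r qu≋0 ⟩
        ⟦ r ⟧ []                     ≈⟨ 0ᴹ-homo r ⟩
        []                           ∎

    coeff-f-0 : ∀ m → coeff (f (suc m)) 0 ≈ 0#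
    coeff-f-0 m = trans (coeff≈ (f-suc m) 0) (trans (coeff-· (α m) (⟦ X̂ ⟧ v) 0)
      (trans (*-congˡ (coeff-X̂-0 v)) (zeroʳ (α m))))
      where
      v : P
      v = ⟦ r ^ suc m ⟧ (e m)

    -- By induction both sequences have the same image under Q, so their difference is a constant;
    -- both constant terms are zero, for `f` because values of x̂ψ have none.
    p≋f : ∀ n → p n ≋ f n
    p≋f zero    = ≈ᴹ-trans (coeffwise basic.initial) (≈ᴹ-sym f-0)
    p≋f (suc n) = x∙y⁻¹≈ε⇒x≈y _ _ (kernel-q (p (suc n) -ₚ f (suc n))
      (begin
        ⟦ q ⟧ (p (suc n) -ₚ f (suc n))
          ≈⟨ +ᴹ-homo q (p (suc n)) (negₚ (f (suc n))) ⟩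
        ⟦ q ⟧ (p (suc n)) +ₚ ⟦ q ⟧ (negₚ (f (suc n)))
          ≈⟨ +ᴹ-cong q-p (-ᴹ-homo q (f (suc n))) ⟩
        [ suc n ]ψ · f n -ₚ ⟦ q ⟧ (f (suc n))
          ≈⟨ x≈y⇒x∙y⁻¹≈ε (≈ᴹ-sym (q-f n)) ⟩
        [] ∎)
      (trans (coeff-+ (p (suc n)) _ 0) (trans (+-cong
        (trans (sym (eval-0 (p (suc n)))) (basic.vanish (suc n)))
        (trans (coeff-neg (f (suc n)) 0) (trans (-‿cong (coeff-f-0 n)) -0#≈0#)))
        (+-identityˡ 0#))))
      where
      q-p : ⟦ q ⟧ (p (suc n)) ≋ [ suc n ]ψ · f n
      q-p = ≈ᴹ-trans (≈ᴹ-sym (Q≋q (p (suc n))))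
        (≈ᴹ-trans (coeffwise (basic.lower (suc n))) (*ₗ-cong refl (p≋f n)))

    -- The four formulas in terms of the given operators.

    S⁻¹ : P → P
    S⁻¹ = inverse S-invertible

    p≋transfer : ∀ n → p n ≋ pincherle Q ((S⁻¹ ^∘ suc n) (X^ n))
    p≋transfer n = ≈ᴹ-trans (p≋f n) (≈ᴹ-trans
      (⟦⟧-cong q′ (≈ᴹ-reflexive (^-apply r (suc n) (e n)))) (≈ᴹ-sym (Q′≋q′ _)))

    p≋x̂S⁻ⁿ : ∀ m → p (suc m) ≋ α m · x̂ψ ((S⁻¹ ^∘ suc m) (X^ m))
    p≋x̂S⁻ⁿ m = ≈ᴹ-trans (p≋f (suc m)) (≈ᴹ-trans (f-suc m)
      (*ₗ-cong refl (⟦⟧-cong X̂ (≈ᴹ-reflexive (^-apply r (suc m) (e m))))))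

    p≋S⁻ⁿ-pincherle : ∀ m → p (suc m) ≋ (S⁻¹ ^∘ suc m) (X^ (suc m)) -ₚ α m · pincherle (S⁻¹ ^∘ suc m) (X^ m)
    p≋S⁻ⁿ-pincherle m = ≈ᴹ-trans (p≋f (suc m)) (≈ᴹ-trans (f-suc m) (≈ᴹ-trans (x̂S⁻ⁿ-pincherle m)
      (+ᴹ-cong (R≋S⁻¹^ (e (suc m))) (-ᴹ‿cong (*ₗ-cong refl
        (+ᴹ-cong (R≋S⁻¹^ (⟦ X̂ ⟧ (e m))) (-ᴹ‿cong (⟦⟧-cong X̂ (R≋S⁻¹^ (e m))))))))))
      where
      R≋S⁻¹^ : ∀ u → ⟦ r ^ suc m ⟧ u ≋ (S⁻¹ ^∘ suc m) u
      R≋S⁻¹^ u = ≈ᴹ-reflexive (^-apply r (suc m) u)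

    -- By (1) at index m, inverting Q' on `p m` gives the polynomial to which x̂ψ is applied in (3).
    p≋rodrigues : ∀ m → p (suc m) ≋ α m · x̂ψ (⟦ q′⁻¹ ⟧ (p m))
    p≋rodrigues m = ≈ᴹ-trans (p≋f (suc m)) (≈ᴹ-trans (f-suc m) (*ₗ-cong refl (⟦⟧-cong X̂ (begin
      ⟦ r ^ suc m ⟧ (e m)   ≈⟨ q′⁻¹-inverseˡ (⟦ r ^ suc m ⟧ (e m)) ⟨
      ⟦ q′⁻¹ ⟧ (f m)        ≈⟨ ⟦⟧-cong q′⁻¹ (p≋f m) ⟨
      ⟦ q′⁻¹ ⟧ (p m)        ∎))))

mainTheorem11 : ∀ {c ℓ₁ ℓ₂} (F : HeytingField c ℓ₁ ℓ₂) (charZero : CharacteristicZero F)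
    (admissible : AdmissibleSequence F) →
    let open PsiCalculus F admissible in
    ∀ (Q S : P → P) (p : ℕ → P) →
    IsDelta Q →
    (S-invertible : InvertibleInΣψ S) →
    Q ≗ₚ ∂ψ ∘ S →
    IsBasicSequence Q p →
    let S⁻¹ = inverse S-invertible in
    (∀ n → .{{_ : NonZero n}} →
    p n ≈ₚ pincherle Q ((S⁻¹ ^∘ suc n) (X^ n)))
    × (∀ n → .{{_ : NonZero n}} →
    p n ≈ₚ (S⁻¹ ^∘ n) (X^ n) -ₚ ([ n ]ψ / fromℕ n ⟨ charZero n ⟩) · pincherle (S⁻¹ ^∘ n) (X^ (pred n)))
    × (∀ n → .{{_ : NonZero n}} →
    p n ≈ₚ ([ n ]ψ / fromℕ n ⟨ charZero n ⟩) · x̂ψ ((S⁻¹ ^∘ n) (X^ (pred n))))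
    × (Σ[ Q′-invertible ∈ InvertibleInΣψ (pincherle Q) ]
    (∀ n → .{{_ : NonZero n}} →
    p n ≈ₚ ([ n ]ψ / fromℕ n ⟨ charZero n ⟩) · x̂ψ (inverse Q′-invertible (p (pred n)))))
mainTheorem11 F charZero admissible Q S p _ S-invertible Q≗∂S basic =
    (λ n → coeff≈ (p≋transfer n))
  -- `NonZero n` rules out zero; at n = m + 1 the predecessor reduces to `m` and the factor n_ψ / n
  -- is `α m`.
  , (λ { (suc m) → coeff≈ (p≋S⁻ⁿ-pincherle m) })
  , (λ { (suc m) → coeff≈ (p≋x̂S⁻ⁿ m) })
  , Q′-invertible
  , (λ { (suc m) → coeff≈ (p≋rodrigues m) })
  where
  open PolynomialOperators F admissible
  open BasicSequence charZero S-invertible Q≗∂S basic
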